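{- Let $\pi = 1 \oplus \rho$ where $\rho$ starts with a descent (i.e. $\rho(1) > \rho(2)$), suppose $\pi$ has no increasing bond, and suppose $\pi$ satisfies condition $(\ddagger)$: there is at least one entry of $\pi$ lying to the right of the entry of value $2$ whose value is less than the value of the leftmost entry of $\rho$ (i.e. less than $\pi(2)$). Then the class $\operatorname{Av}(\pi)$ is not deflatable.
   Context: A permutation $\alpha$ is contained in $\beta$ if $\beta$ has a subsequence in the same relative order as $\alpha$; a class is a set of permutations closed under taking contained permutations; $\operatorname{Av}(\pi)$ is the class of permutations not containing $\pi$. $1\oplus\rho$ is the permutation $1\,(\rho(1)+1)\,(\rho(2)+1)\cdots$, i.e. a new minimum entry placed before a copy of $\rho$. A bond of a permutation is a pair of entries in adjacent positions whose values differ by $1$; it is increasing if they form the pattern $12$. An interval of a permutation is a set of entries whose positions and values each form a set of consecutive integers, the whole permutation not counting as an interval; a permutation is simple if all its intervals are single entries (so $1$, $12$, $21$ are simple). A class $\mathcal{C}$ is deflatable if there is a proper subclass $\mathcal{D}\subsetneq\mathcal{C}$ with $\mathcal{C}\subseteq\langle\mathcal{D}\rangle$, where the substitution closure $\langle\mathcal{D}\rangle$ is the largest class whose simple permutations are exactly those of $\mathcal{D}$; equivalently, $\mathcal{C}$ is not deflatable if and only if every permutation in $\mathcal{C}$ is contained in some simple permutation belonging to $\mathcal{C}$. -}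

module Defs where

open import Level using (0ℓ)
open import Data.Nat using (ℕ; zero; suc; _<_; _≤_; _+_)
open import Data.List using (List; []; _∷_; _++_; length; map; zip; take; drop; applyUpTo)
open import Data.List.Membership.Propositional using (_∈_)
open import Data.List.Relation.Binary.Sublist.Propositional using (_⊆_)
open import Data.List.Relation.Binary.Permutation.Propositional using (_↭_)
open import Data.Product using (Σ; ∃; ∃-syntax; _×_; _,_; proj₁; proj₂)
open import Data.Empty using (⊥)
open import Relation.Nullary using (¬_)
open import Relation.Binary.PropositionalEquality using (_≡_)
open import Function.Bundles using (_⇔_)

-- A permutation of length n is a list of the values 1..n in some order
-- (one-line notation, values starting at 1).
Perm : Set
Perm = List ℕ

IsPerm : Perm → Set
IsPerm σ = σ ↭ applyUpTo suc (length σ)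

SameOrder : List ℕ → List ℕ → Set
SameOrder xs ys =
  length xs ≡ length ys ×
  (∀ {p q} → p ∈ zip xs ys → q ∈ zip xs ys →
     (proj₁ p < proj₁ q ⇔ proj₂ p < proj₂ q))

_≼_ : Perm → Perm → Set
α ≼ β = ∃[ s ] (s ⊆ β × SameOrder α s)

IsClass : (Perm → Set) → Set
IsClass C =
  (∀ σ → C σ → IsPerm σ) ×
  (∀ σ τ → C σ → IsPerm τ → τ ≼ σ → C τ)

Av : Perm → Perm → Set
Av π σ = IsPerm σ × ¬ (π ≼ σ)

IsIntervalSeg : Perm → ℕ → ℕ → Set
IsIntervalSeg σ i k =
  length (take k (drop i σ)) ≡ k ×
  (∃[ m ] (take k (drop i σ) ↭ applyUpTo (m +_) k))

IsSimple : Perm → Set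
IsSimple σ = ∀ i k → 2 ≤ k → k < length σ → ¬ IsIntervalSeg σ i k

-- Substitution closure ⟨D⟩ of a class D: the largest class whose simple
-- permutations are exactly those of D, i.e. all permutations every simple
-- permutation contained in which lies in D.
SubstClosure : (Perm → Set) → Perm → Set
SubstClosure D σ = IsPerm σ × (∀ τ → IsSimple τ → IsPerm τ → τ ≼ σ → D τ)

ProperSubclass : (Perm → Set) → (Perm → Set) → Set
ProperSubclass D C =
  IsClass D × (∀ σ → D σ → C σ) × (∃[ σ ] (C σ × ¬ D σ))

Deflatable : (Perm → Set) → Set₁
Deflatable C = Σ (Perm → Set) λ D → ProperSubclass D C × (∀ σ → C σ → SubstClosure D σ)

oneSum : Perm → Perm
oneSum ρ = 1 ∷ map suc ρ

NoIncreasingBond : Perm → Set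
NoIncreasingBond π = ∀ xs x ys → ¬ (π ≡ xs ++ x ∷ suc x ∷ ys)

-- condition (‡): some entry to the right of the entry 2 has value less than v (= π(2))
Ddagger : Perm → ℕ → Set
Ddagger π v = ∃[ xs ] ∃[ ys ] (π ≡ xs ++ 2 ∷ ys × ∃[ y ] (y ∈ ys × y < v))

{-# OPTIONS --safe #-}

-- Regard permutations as finite sets of points. It suffices to enlarge every σ avoiding π = 1 ⊕ ρ,
-- one point at a time, to a simple permutation avoiding π. A new bottommost and rightmost point
-- destroys all decompositions σ = α ⊕ β, and a decomposition α ⊖ β is destroyed by a point just left
-- of the last point of α and just below the highest point of β. Then take a maximal proper interval I.
-- * If a point lies below and left of I, let d be the lowest point left of I and insert a point inside
--   the column range of I, just below d. It is a left-to-right minimum that d could replace in any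
--   copy of π.
-- * Otherwise let e be the first point right of I. If e lies below I, insert a point just left of the
--   last point of I and just below the highest point below I. It could only play the 1 of π, and by
--   (‡) the copy of ρ avoids I, so e could play the 1 instead.
-- * If e lies above I, let y be the lowest point above and right of I. Insert a point just above the
--   lowest point of I, immediately left of y (immediately right if y = e). By (‡) a copy of π through
--   it could use y instead, or it contains the new point and y as an increasing bond.
-- The new point cuts I, and J ↦ J ∖ {new} is injective on intervals since I is maximal and σ is
-- indecomposable; hence the number of intervals decreases.

module Submission where

open import Defs
open import Data.Bool using (true; false; Bool; not; _∨_)
import Data.Bool.Properties as Bool
open import Data.Nat using (ℕ; zero; suc; _<_; _≤_; _+_; _∸_; z≤n; s≤s; _<?_)
open import Data.Nat.Properties
open import Data.Fin as F using (Fin; zero; suc; toℕ)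
import Data.Fin.Properties as F
open import Data.Unit using (⊤)
open import Data.Product using (∃; ∃₂; _×_; _,_; proj₁; proj₂)
open import Data.Sum using (_⊎_; inj₁; inj₂)
open import Data.Empty using (⊥; ⊥-elim)
open import Relation.Nullary using (¬_; yes; no; Dec)
open import Relation.Nullary.Decidable using (_×-dec_)
open import Relation.Unary using (Decidable)
open import Relation.Binary using (tri<; tri≈; tri>)
open import Relation.Binary.PropositionalEquality
open import Function using (_∘_; _⇔_; mk⇔; Equivalence)
open import Data.List using (List; []; _∷_; _++_; length; map; zip; take; drop; applyUpTo; lookup; tabulate; allFin)
open import Data.List.Properties using (length-map; length-tabulate; map-tabulate; tabulate-lookup; map-applyUpTo;
  length-applyUpTo; take-map; drop-map; take++drop≡id)
open import Data.List.Relation.Unary.Any using (here; there; index)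
open import Data.List.Relation.Unary.Any.Properties using (lookup-index)
open import Data.List.Relation.Unary.All as All using (All; []; _∷_)
open import Data.List.Relation.Unary.AllPairs as AllPairs using (AllPairs; []; _∷_)
import Data.List.Relation.Unary.AllPairs.Properties as AllPairs
open import Data.List.Relation.Unary.Unique.Propositional using (Unique)
import Data.List.Relation.Unary.Unique.Propositional.Properties as Unique
open import Data.List.Relation.Unary.Sorted.TotalOrder.Properties using (Sorted⇒AllPairs)
open import Data.List.Membership.Propositional using () renaming (_∈_ to _∈ᴸ_)
open import Data.List.Membership.Propositional.Properties
  using (∈-∃++; ∈-++⁻; ∈-++⁺ˡ; ∈-++⁺ʳ; ∈-map⁺; ∈-map⁻; ∈-lookup; ∈-allFin; ∈-applyUpTo⁺; ∈-applyUpTo⁻)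
open import Data.List.Relation.Binary.Sublist.Propositional
  using (_⊆_; []; _∷_; _∷ʳ_; minimum; ⊆-refl) renaming (lookup to ⊆-lookup)
import Data.List.Relation.Binary.Sublist.Propositional.Properties as Sublist
open import Data.List.Relation.Binary.Permutation.Propositional
  using (_↭_; ↭-refl; ↭-sym; ↭-trans; prep; ↭⇒↭ₛ)
open import Data.List.Relation.Binary.Permutation.Propositional.Properties
  using (∈-resp-↭; ↭-length; shift; map⁺)
import Data.List.Relation.Binary.Permutation.Setoid.Properties as ↭ₛ
import Data.List.Sort as Sort
import Relation.Binary.Construct.On as On

-- Bounds on the number of elements of a predicate.

private variable
  l m n : ℕ
  A B : Set

-- A cardinality bound without an enumeration: whichever element is picked, at most `n` inequivalent
-- ones remain. Applying a bound `suc n` to one chosen element is what lowers the counts of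
-- intervals and cuts below.
AtMost : {A : Set} (_≈_ : A → A → Set) (P : A → Set) → ℕ → Set
AtMost _≈_ P zero    = ∀ x → ¬ P x
AtMost _≈_ P (suc n) = ∀ x → P x → AtMost _≈_ (λ y → P y × ¬ (x ≈ y)) n

module _ {A B : Set} {_≈ᴬ_ : A → A → Set} {_≈ᴮ_ : B → B → Set} where

  -- Removing `y` from `Q` is matched by removing `f y` from `P`; injectivity keeps the images of
  -- the remaining elements inequivalent to `f y`.
  AtMost-injection : {P : A → Set} {Q : B → Set} (f : B → A) →
    (∀ y → Q y → P (f y)) →
    (∀ x y → Q x → Q y → f x ≈ᴬ f y → x ≈ᴮ y) →
    ∀ n → AtMost _≈ᴬ_ P n → AtMost _≈ᴮ_ Q n
  AtMost-injection f QP inj zero    am y Qy = am (f y) (QP y Qy)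
  AtMost-injection f QP inj (suc n) am y Qy =
    AtMost-injection f
      (λ z (Qz , y≉z) → QP z Qz , λ fy≈fz → y≉z (inj y z Qy Qz fy≈fz))
      (λ x z (Qx , _) (Qz , _) → inj x z Qx Qz)
      n (am (f y) (QP y Qy))

module _ {A : Set} {_≈_ : A → A → Set} where

  AtMost-⊆ : {P Q : A → Set} → (∀ x → Q x → P x) → ∀ n → AtMost _≈_ P n → AtMost _≈_ Q n
  AtMost-⊆ Q⊆P = AtMost-injection (λ x → x) Q⊆P (λ _ _ _ _ x≈y → x≈y)

  -- Each picked element is charged to a side that contains it and lowers only that bound.
  AtMost-∪ : ∀ m n {P Q R : A → Set} → AtMost _≈_ P m → AtMost _≈_ Q n →
    (∀ x → R x → P x ⊎ Q x) → AtMost _≈_ R (m + n)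
  AtMost-∪ zero zero p q R⊆ x Rx with R⊆ x Rx
  ... | inj₁ Px = p x Px
  ... | inj₂ Qx = q x Qx
  AtMost-∪ zero (suc n) p q R⊆ x Rx with R⊆ x Rx
  ... | inj₁ Px = ⊥-elim (p x Px)
  ... | inj₂ Qx = AtMost-∪ zero n p (q x Qx) λ y (Ry , x≉y) → split y x≉y (R⊆ y Ry)
    where
    split : ∀ y → ¬ (x ≈ y) → _ → _
    split y x≉y (inj₁ Py) = inj₁ Py
    split y x≉y (inj₂ Qy) = inj₂ (Qy , x≉y)
  AtMost-∪ (suc m) n {P} {Q} {R} p q R⊆ x Rx with R⊆ x Rx
  ... | inj₁ Px = AtMost-∪ m n (p x Px) q λ y (Ry , x≉y) → split y x≉y (R⊆ y Ry)
    where
    split : ∀ y → ¬ (x ≈ y) → P y ⊎ Q y → (P y × ¬ (x ≈ y)) ⊎ Q y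
    split y x≉y (inj₁ Py) = inj₁ (Py , x≉y)
    split y x≉y (inj₂ Qy) = inj₂ Qy
  AtMost-∪ (suc m) zero p q R⊆ x Rx | inj₂ Qx = ⊥-elim (q x Qx)
  AtMost-∪ (suc m) (suc n) {P} {Q} {R} p q R⊆ x Rx | inj₂ Qx =
    subst (AtMost _≈_ _) (sym (+-suc m n))
      (AtMost-∪ (suc m) n p (q x Qx) λ y (Ry , x≉y) → split y x≉y (R⊆ y Ry))
    where
    split : ∀ y → ¬ (x ≈ y) → P y ⊎ Q y → P y ⊎ (Q y × ¬ (x ≈ y))
    split y x≉y (inj₁ Py) = inj₁ Py
    split y x≉y (inj₂ Qy) = inj₂ (Qy , x≉y)

-- Finite subsets and extremal points.

Subset : ℕ → Set
Subset n = Fin n → Bool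

infix 4 _∈_ _∉_
_∈_ _∉_ : Fin n → Subset n → Set
i ∈ S = S i ≡ true
i ∉ S = S i ≡ false

_∈?_ : (i : Fin n) (S : Subset n) → i ∈ S ⊎ i ∉ S
i ∈? S with S i
... | true  = inj₁ refl
... | false = inj₂ refl

∈∉-⊥ : ∀ {b} → b ≡ true → b ≡ false → ⊥
∈∉-⊥ refl ()

∈∉-≢ : (S : Subset n) {i j : Fin n} → i ∈ S → j ∉ S → i ≢ j
∈∉-≢ S i∈ j∉ refl = ∈∉-⊥ i∈ j∉

tail-≗ : {S T : Subset (suc n)} → S zero ≡ T zero → S ∘ suc ≗ T ∘ suc → S ≗ T
tail-≗ p q zero    = p
tail-≗ p q (suc i) = q i

-- Split by the value at `zero`: each half injects into the subsets of `Fin n` by restriction along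
-- `suc`. The bound itself is irrelevant; it only drives the inductions on intervals and cuts.
subsets-finite : ∀ n (P : Subset n → Set) → ∃ (AtMost _≗_ P)
subsets-finite zero P = 1 , λ x _ y (_ , x≗̸y) → x≗̸y λ ()
subsets-finite (suc n) P =
  _ , AtMost-∪ _ _ (half true) (half false) λ S PS → split S PS
  where
  half : ∀ b → AtMost _≗_ (λ S → P S × S zero ≡ b) (proj₁ (subsets-finite n λ _ → ⊤))
  half b = AtMost-injection (_∘ suc) (λ _ _ → _)
    (λ S T (_ , p) (_ , q) → tail-≗ (trans p (sym q)))
    _ (proj₂ (subsets-finite n _))
  split : ∀ S → P S → (P S × zero ∈ S) ⊎ (P S × zero ∉ S)
  split S PS with zero ∈? S
  ... | inj₁ p = inj₁ (PS , p)
  ... | inj₂ p = inj₂ (PS , p)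

module Extremum (_⊑_ : ℕ → ℕ → Set)
  (total : ∀ x y → x ⊑ y ⊎ y ⊑ x) (transitive : ∀ {x y z} → x ⊑ y → y ⊑ z → x ⊑ z) where

  reflexive : ∀ x → x ⊑ x
  reflexive x with total x x
  ... | inj₁ p = p
  ... | inj₂ p = p

  extremum : ∀ {n} {P : Fin n → Set} → Decidable P → (f : Fin n → ℕ) → ∃ P →
    ∃ λ k → P k × (∀ l → P l → f k ⊑ f l)
  extremum {suc n} {P} P? f (i , Pi) with F.any? (P? ∘ suc) | P? zero
  ... | no ¬Q | no ¬P0 = ⊥-elim (absurd i Pi)
    where
    absurd : ∀ i → P i → ⊥
    absurd zero    P0 = ¬P0 P0
    absurd (suc i) Pi = ¬Q (i , Pi)
  ... | no ¬Q | yes P0 = zero , P0 , λ { zero _ → reflexive _ ; (suc l) Pl → ⊥-elim (¬Q (l , Pl)) }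
  ... | yes Q | P0? with extremum (P? ∘ suc) (f ∘ suc) Q
  extremum P? f (i , Pi) | yes Q | no ¬P0 | k , Pk , k-ext =
    suc k , Pk , λ { zero P0 → ⊥-elim (¬P0 P0) ; (suc l) → k-ext l }
  extremum P? f (i , Pi) | yes Q | yes P0 | k , Pk , k-ext with total (f zero) (f (suc k))
  ... | inj₁ ≤k = zero , P0 , λ { zero _ → reflexive _ ; (suc l) Pl → transitive ≤k (k-ext l Pl) }
  ... | inj₂ k≤ = suc k , Pk , λ { zero _ → k≤ ; (suc l) → k-ext l }

open Extremum _≤_ ≤-total ≤-trans using () renaming (extremum to least)
open Extremum (λ x y → y ≤ x) (λ x y → ≤-total y x) (λ p q → ≤-trans q p)
  using () renaming (extremum to greatest)

-- Point configurations, embeddings, intervals and cuts.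

Injective : (Fin n → ℕ) → Set
Injective Z = ∀ {i j} → Z i ≡ Z j → i ≡ j

≤∧≢⇒<-inj : {Z : Fin n → ℕ} → Injective Z → ∀ {i j} → Z i ≤ Z j → i ≢ j → Z i < Z j
≤∧≢⇒<-inj inj i≤j i≢j = ≤∧≢⇒< i≤j (i≢j ∘ inj)

-- A configuration of points is given by two injective coordinate functions X, Y.
-- The new point `zero` gets the coordinate below which the old values < a lie.
ext : ℕ → (Fin n → ℕ) → Fin (suc n) → ℕ
ext a Z zero    = a + a
ext a Z (suc i) = suc (Z i + Z i)

module _ {a : ℕ} {Z : Fin n → ℕ} where

  -- Old coordinates z become the odd numbers 2z + 1 and the new one the even number 2a, so ties
  -- cannot occur. Here z + 1 ≤ a doubles to 2z + 2 ≤ 2a.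
  old<new : ∀ {i} → Z i < a → ext a Z (suc i) < ext a Z zero
  old<new {i} z<a = subst (_≤ a + a) (cong suc (+-suc (Z i) (Z i))) (+-mono-≤ z<a z<a)

  new<old : ∀ {i} → a ≤ Z i → ext a Z zero < ext a Z (suc i)
  new<old a≤z = s≤s (+-mono-≤ a≤z a≤z)

  old<old : ∀ {i j} → Z i < Z j → ext a Z (suc i) < ext a Z (suc j)
  old<old z<z = s≤s (+-mono-<-≤ z<z (<⇒≤ z<z))

  old<new⁻ : ∀ {i} → ext a Z (suc i) < ext a Z zero → Z i < a
  old<new⁻ {i} lt = ≰⇒> λ a≤z → <-asym lt (new<old {i} a≤z)

  new<old⁻ : ∀ {i} → ext a Z zero < ext a Z (suc i) → a ≤ Z i
  new<old⁻ {i} lt = ≮⇒≥ λ z<a → <-asym lt (old<new {i} z<a)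

  old<old⁻ : ∀ {i j} → ext a Z (suc i) < ext a Z (suc j) → Z i < Z j
  old<old⁻ {i} {j} (s≤s lt) = ≰⇒> λ zj≤zi → <⇒≱ lt (+-mono-≤ zj≤zi zj≤zi)

  new≢old : ∀ {i} → ext a Z zero ≢ ext a Z (suc i)
  new≢old {i} eq with a Data.Nat.≤? Z i
  ... | yes a≤z = <-irrefl eq (new<old {i} a≤z)
  ... | no  a≰z = <-irrefl (sym eq) (old<new {i} (≰⇒> a≰z))

  ext-injective : Injective Z → Injective (ext a Z)
  ext-injective inj {zero}  {zero}  eq = refl
  ext-injective inj {zero}  {suc j} eq = ⊥-elim (new≢old eq)
  ext-injective inj {suc i} {zero}  eq = ⊥-elim (new≢old (sym eq))
  ext-injective inj {suc i} {suc j} eq with <-cmp (Z i) (Z j)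
  ... | tri< lt _ _ = ⊥-elim (<-irrefl eq (old<old {i} {j} lt))
  ... | tri≈ _ e _  = cong suc (inj e)
  ... | tri> _ _ gt = ⊥-elim (<-irrefl (sym eq) (old<old {j} {i} gt))

record Emb (p : Fin m → ℕ) (X Y : Fin n → ℕ) (φ : Fin m → Fin n) : Set where
  field
    pos : ∀ {i j} → i F.< j → X (φ i) < X (φ j)
    val : ∀ {i j} → p i < p j → Y (φ i) < Y (φ j)

Avoids : (Fin m → ℕ) → (X Y : Fin n → ℕ) → Set
Avoids p X Y = ∀ φ → ¬ Emb p X Y φ

-- A copy of p in an extended configuration that uses the new point, as entry `new`;
-- κ gives the other entries, its value at `new` is irrelevant.
record Use (p : Fin m → ℕ) (a b : ℕ) (X Y : Fin n → ℕ) : Set where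
  field
    new   : Fin m
    κ     : Fin m → Fin n
    pos   : ∀ {i j} → i ≢ new → j ≢ new → i F.< j → X (κ i) < X (κ j)
    val   : ∀ {i j} → i ≢ new → j ≢ new → p i < p j → Y (κ i) < Y (κ j)
    left  : ∀ {j} → j F.< new → X (κ j) < a
    right : ∀ {j} → new F.< j → a ≤ X (κ j)
    below : ∀ {j} → p j < p new → Y (κ j) < b
    above : ∀ {j} → p new < p j → b ≤ Y (κ j)

  -- The usual way to refute a `Use`: an old point `d` that compares with the other entries as the
  -- new point must takes over its role, which leaves a copy of `p` among old points.
  replace : Avoids p X Y → (d : Fin n) →
    (∀ {j} → j F.< new → X (κ j) < X d) → (∀ {j} → new F.< j → X d < X (κ j)) →
    (∀ {j} → p j < p new → Y (κ j) < Y d) → (∀ {j} → p new < p j → Y d < Y (κ j)) → ⊥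
  replace av d l r u o = av φ record { pos = φ-pos ; val = φ-val }
    where
    φ : Fin m → Fin n
    φ j with j F.≟ new
    ... | yes _ = d
    ... | no  _ = κ j
    φ-pos : ∀ {i j} → i F.< j → X (φ i) < X (φ j)
    φ-pos {i} {j} i<j with i F.≟ new | j F.≟ new
    ... | yes refl | yes refl = ⊥-elim (<-irrefl refl i<j)
    ... | yes refl | no _     = r i<j
    ... | no _     | yes refl = l i<j
    ... | no i≢    | no j≢    = pos i≢ j≢ i<j
    φ-val : ∀ {i j} → p i < p j → Y (φ i) < Y (φ j)
    φ-val {i} {j} i<j with i F.≟ new | j F.≟ new
    ... | yes refl | yes refl = ⊥-elim (<-irrefl refl i<j)
    ... | yes refl | no _     = o i<j
    ... | no _     | yes refl = u i<j
    ... | no i≢    | no j≢    = val i≢ j≢ i<j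

ext-avoids : {p : Fin m → ℕ} {X Y : Fin n → ℕ} {a b : ℕ} → Fin n →
  Avoids p X Y → ¬ Use p a b X Y → Avoids p (ext a X) (ext b Y)
ext-avoids {m} {n} {p} {X} {Y} {a} {b} d av ¬use φ emb with F.any? (λ i → φ i F.≟ zero)
... | no unused = av κ record { pos = κ-pos ; val = κ-val }
  where
  κ : Fin m → Fin n
  κ j = F.punchOut {i = zero} (λ eq → unused (j , sym eq))
  κ-eq : ∀ j → φ j ≡ suc (κ j)
  κ-eq j = sym (F.punchIn-punchOut (λ eq → unused (j , sym eq)))
  κ-pos : ∀ {i j} → i F.< j → X (κ i) < X (κ j)
  κ-pos {i} {j} i<j = old<old⁻ {a = a} {Z = X} (subst₂ (λ u v → ext a X u < ext a X v) (κ-eq i) (κ-eq j) (Emb.pos emb i<j))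
  κ-val : ∀ {i j} → p i < p j → Y (κ i) < Y (κ j)
  κ-val {i} {j} i<j = old<old⁻ {a = b} {Z = Y} (subst₂ (λ u v → ext b Y u < ext b Y v) (κ-eq i) (κ-eq j) (Emb.val emb i<j))
... | yes (w , φw≡0) = ¬use record
  { new = w ; κ = κ
  ; pos = λ {i} {j} i≢ j≢ i<j → old<old⁻ {a = a} {Z = X}
      (subst₂ (λ u v → ext a X u < ext a X v) (κ-eq i≢) (κ-eq j≢) (Emb.pos emb i<j))
  ; val = λ {i} {j} i≢ j≢ i<j → old<old⁻ {a = b} {Z = Y}
      (subst₂ (λ u v → ext b Y u < ext b Y v) (κ-eq i≢) (κ-eq j≢) (Emb.val emb i<j))
  ; left = λ {j} j<w → old<new⁻ {a = a} {Z = X}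
      (subst₂ (λ u v → ext a X u < ext a X v) (κ-eq (F.<⇒≢ j<w)) φw≡0 (Emb.pos emb j<w))
  ; right = λ {j} w<j → new<old⁻ {a = a} {Z = X}
      (subst₂ (λ u v → ext a X u < ext a X v) φw≡0 (κ-eq (≢-sym (F.<⇒≢ w<j))) (Emb.pos emb w<j))
  ; below = λ {j} j<w → old<new⁻ {a = b} {Z = Y}
      (subst₂ (λ u v → ext b Y u < ext b Y v) (κ-eq (λ { refl → <-irrefl refl j<w })) φw≡0 (Emb.val emb j<w))
  ; above = λ {j} w<j → new<old⁻ {a = b} {Z = Y}
      (subst₂ (λ u v → ext b Y u < ext b Y v) φw≡0 (κ-eq (λ { refl → <-irrefl refl w<j })) (Emb.val emb w<j))
  }
  where
  pred′ : Fin (suc n) → Fin n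
  -- A default value: `κ` is total, and `d` fills it at the entry played by the new point.
  pred′ zero    = d
  pred′ (suc k) = k
  κ : Fin m → Fin n
  κ = pred′ ∘ φ
  φ-injective : ∀ {i j} → φ i ≡ φ j → i ≡ j
  φ-injective {i} {j} eq with F.<-cmp i j
  ... | tri< lt _ _ = ⊥-elim (<-irrefl (cong (ext a X) eq) (Emb.pos emb lt))
  ... | tri≈ _ e _  = e
  ... | tri> _ _ gt = ⊥-elim (<-irrefl (cong (ext a X) (sym eq)) (Emb.pos emb gt))
  ≢zero⇒suc : ∀ k → k ≢ zero → k ≡ suc (pred′ k)
  ≢zero⇒suc zero    k≢0 = ⊥-elim (k≢0 refl)
  ≢zero⇒suc (suc k) _   = refl
  κ-eq : ∀ {j} → j ≢ w → φ j ≡ suc (κ j)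
  κ-eq {j} j≢w = ≢zero⇒suc (φ j) λ φj≡0 → j≢w (φ-injective (trans φj≡0 (sym φw≡0)))

-- The properties of π = 1 ⊕ ρ that matter: `one` and `two` carry the values 1 and 2, `hd` is the
-- first entry of ρ, `tee` is the entry provided by (‡).
record Pattern (p : Fin m → ℕ) : Set where
  field
    one two hd tee : Fin m
    p-injective : ∀ {i j} → p i ≡ p j → i ≡ j
    one-first : ∀ j → one ≡ j ⊎ (one F.< j × p one < p j)
    two-next  : ∀ j → one ≡ j ⊎ (two ≡ j ⊎ p two < p j)
    hd-next   : ∀ j → one ≡ j ⊎ (hd ≡ j ⊎ hd F.< j)
    one<two   : p one < p two
    one<hd    : one F.< hd
    two<tee   : two F.< tee
    tee<hd    : p tee < p hd
    no-bond   : ∀ i j → i F.< j → p i < p j →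
                ∃ λ l → (i F.< l × l F.< j) ⊎ (p i < p l × p l < p j)

  one≢two : one ≢ two
  one≢two eq = <-irrefl (cong p eq) one<two

  one<two-pos : one F.< two
  one<two-pos with one-first two
  ... | inj₁ eq       = ⊥-elim (one≢two eq)
  ... | inj₂ (lt , _) = lt

  one<tee-pos : one F.< tee
  one<tee-pos = F.<-trans {i = one} {j = two} {k = tee} one<two-pos two<tee

  two<tee-val : p two < p tee
  two<tee-val with two-next tee
  ... | inj₁ eq        = ⊥-elim (F.<-irrefl eq one<tee-pos)
  ... | inj₂ (inj₁ eq) = ⊥-elim (F.<-irrefl eq two<tee)
  ... | inj₂ (inj₂ lt) = lt

-- Phrased through outsiders, which lie on one side of all of `I`. For injective `Z` this says that
-- the values on `I` are consecutive among those of the configuration.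
Convex : (Fin n → ℕ) → Subset n → Set
Convex Z I = ∀ {k i j} → k ∉ I → i ∈ I → j ∈ I → Z k < Z i → Z k < Z j

record Interval (X Y : Fin n → ℕ) (I : Subset n) : Set where
  field
    two-points : ∃₂ λ i j → i ∈ I × j ∈ I × i ≢ j
    outside    : ∃ λ k → k ∉ I
    convexˣ    : Convex X I
    convexʸ    : Convex Y I

-- For `SumOrder` this is a decomposition α ⊕ β, for `SkewOrder` α ⊖ β; `S` consists of the points
-- of α.
Cut : (Fin n → Fin n → Set) → Subset n → Set
Cut R S = ∃ (_∈ S) × ∃ (_∉ S) × (∀ {i j} → i ∈ S → j ∉ S → R i j)

SumOrder SkewOrder : (X Y : Fin n → ℕ) → Fin n → Fin n → Set
SumOrder  X Y i j = X i < X j × Y i < Y j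
SkewOrder X Y i j = X i < X j × Y j < Y i

beside : {Z : Fin n → ℕ} → Injective Z → {I : Subset n} → Convex Z I → ∀ {k i} → k ∉ I → i ∈ I →
  (∀ {j} → j ∈ I → Z k < Z j) ⊎ (∀ {j} → j ∈ I → Z j < Z k)
beside {Z = Z} inj {I} conv {k} {i} k∉ i∈ with <-cmp (Z k) (Z i)
... | tri< lt _ _ = inj₁ λ j∈ → conv k∉ i∈ j∈ lt
... | tri≈ _ eq _ = ⊥-elim (∈∉-≢ I i∈ k∉ (sym (inj eq)))
... | tri> _ _ gt = inj₂ λ j∈ → ≤∧≢⇒<-inj inj
      (≮⇒≥ λ k<j → <-asym gt (conv k∉ j∈ i∈ k<j)) (∈∉-≢ I j∈ k∉)

-- Insertions that create no copy of the pattern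

module Insertion {p : Fin m → ℕ} (𝒫 : Pattern p) {X Y : Fin n → ℕ}
  (injˣ : Injective X) (injʸ : Injective Y) (av : Avoids p X Y) where
  open Pattern 𝒫

  module LeftToRightMinimum {a b} (lrmin : ∀ k → X k < a → b ≤ Y k) (U : Use p a b X Y) where
    open Use U

    -- In any role other than that of the 1, the new point would have the entry `one` of the copy to
    -- its left and below it, where `lrmin` leaves no point.
    new-first : ∀ j → new ≡ j ⊎ (new F.< j × p new < p j)
    new-first j with one-first new
    ... | inj₂ (pos< , val<) = ⊥-elim (<⇒≱ (below val<) (lrmin _ (left pos<)))
    ... | inj₁ refl          = one-first j

    one≡new : one ≡ new
    one≡new with new-first one | one-first new
    ... | inj₁ eq        | _              = sym eq
    ... | inj₂ _         | inj₁ eq        = eq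
    ... | inj₂ (lt , _)  | inj₂ (gt , _)  = ⊥-elim (F.<-asym lt gt)

    not-left : ∀ {j} → ¬ (j F.< new)
    not-left {j} j<new with new-first j
    ... | inj₁ refl     = F.<-irrefl refl j<new
    ... | inj₂ (lt , _) = F.<-asym lt j<new

    not-below : ∀ {j} → ¬ (p j < p new)
    not-below {j} j<new with new-first j
    ... | inj₁ refl     = <-irrefl refl j<new
    ... | inj₂ (_ , lt) = <-asym lt j<new

    new<hd : new F.< hd
    new<hd = subst (F._< hd) one≡new one<hd

    new<two : p new < p two
    new<two = subst (λ i → p i < p two) one≡new one<two

    new≢two : two ≢ new
    new≢two refl = <-irrefl refl new<two

    new≢hd : hd ≢ new
    new≢hd refl = F.<-irrefl refl new<hd

    new<two-pos : new F.< two
    new<two-pos = subst (F._< two) one≡new one<two-pos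

    new<tee-pos : new F.< tee
    new<tee-pos = F.<-trans {i = new} {j = two} {k = tee} new<two-pos two<tee

    new≢tee : tee ≢ new
    new≢tee refl = F.<-irrefl refl new<tee-pos

    new<tee : p new < p tee
    new<tee = <-trans new<two two<tee-val

    new<hd-val : p new < p hd
    new<hd-val = <-trans new<tee tee<hd

    two<tee-Y : Y (κ two) < Y (κ tee)
    two<tee-Y = val new≢two new≢tee two<tee-val

    tee<hd-Y : Y (κ tee) < Y (κ hd)
    tee<hd-Y = val new≢tee new≢hd tee<hd

    hd≤ : ∀ {j} → new F.< j → X (κ hd) ≤ X (κ j)
    hd≤ {j} new<j with hd-next j
    ... | inj₁ refl        = ⊥-elim (F.<-irrefl (sym one≡new) new<j)
    ... | inj₂ (inj₁ refl) = ≤-refl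
    ... | inj₂ (inj₂ lt)   = <⇒≤ (pos new≢hd (λ { refl → F.<-irrefl refl new<j }) lt)

  -- A bottommost point is a left-to-right minimum and so plays the 1; but nothing lies to its right
  -- to play `hd`.
  append-avoids : ∀ {a} → (∀ k → X k < a) → ¬ Use p a 0 X Y
  append-avoids rightmost U = <⇒≱ (rightmost _) (right new<hd)
    where
    open Use U
    open LeftToRightMinimum (λ _ _ → z≤n) U

  -- The other entries lie right of the new column, so none of them is `d`; being above the new
  -- point, which is directly below `d`, they are above `d`. Hence `d` can play the 1.
  below-minimum-avoids : ∀ {a d} → X d < a → (∀ k → X k < a → Y d ≤ Y k) → ¬ Use p a (Y d) X Y
  below-minimum-avoids {a} {d} d<a lrmin U = replace av d
    (⊥-elim ∘ not-left) (λ lt → <-≤-trans d<a (right lt))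
    (⊥-elim ∘ not-below) above′
    where
    open Use U
    open LeftToRightMinimum lrmin U
    above′ : ∀ {j} → p new < p j → Y d < Y (κ j)
    above′ {j} lt with new-first j
    ... | inj₁ refl = ⊥-elim (<-irrefl refl lt)
    ... | inj₂ (new<j , _) = ≤∧≢⇒<-inj injʸ (above lt)
          (λ { d≡κ → <⇒≱ d<a (subst (λ k → a ≤ X k) (sym d≡κ) (right new<j)) })

  -- A pigeonhole argument: the new point plays the 1, so `two`, `tee` and `hd` have three different
  -- heights northeast of it, where only `l` and `t` lie.
  skew-avoids : ∀ {l t} → (∀ k → X k < X l → Y t ≤ Y k) →
    (∀ k → X l ≤ X k → Y t ≤ Y k → k ≡ l ⊎ k ≡ t) → ¬ Use p (X l) (Y t) X Y
  skew-avoids {l} {t} lrmin northeast U = go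
    (northeast _ (right new<two-pos) (above new<two))
    (northeast _ (right new<tee-pos) (above new<tee))
    (northeast _ (right new<hd) (above new<hd-val))
    where
    open Use U
    open LeftToRightMinimum lrmin U
    same : ∀ {i j d} → κ i ≡ d → κ j ≡ d → ¬ (Y (κ i) < Y (κ j))
    same i≡d j≡d = <-irrefl (cong Y (trans i≡d (sym j≡d)))
    go : κ two ≡ l ⊎ κ two ≡ t → κ tee ≡ l ⊎ κ tee ≡ t → κ hd ≡ l ⊎ κ hd ≡ t → ⊥
    go _         (inj₂ e) _          = <⇒≱ two<tee-Y (subst (λ k → Y k ≤ Y (κ two)) (sym e) (above new<two))
    go _         (inj₁ e) (inj₁ e′)  = same e e′ tee<hd-Y
    go (inj₁ e)  (inj₁ e′) _         = same e e′ two<tee-Y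
    go (inj₂ e)  _        (inj₂ e′)  = same e e′ (<-trans two<tee-Y tee<hd-Y)

  -- In the application `u` is the last point of the interval, `q` the highest point below it and
  -- `e` the first point to its right. Since `two` and `tee` are lower than `hd` and northeast of
  -- the new point, `hd` is neither `u` nor `q`.
  below-east-avoids : ∀ {u q e} → (∀ k → X k < X u → Y q ≤ Y k) →
    (∀ k → X u ≤ X k → Y q ≤ Y k → k ≡ u ⊎ (k ≡ q ⊎ (X e < X k × Y u < Y k))) →
    Y e ≤ Y q → ¬ Use p (X u) (Y q) X Y
  below-east-avoids {u} {q} {e} lrmin northeast e≤q U = go (northeast _ (right new<hd) (above new<hd-val))
    where
    open Use U
    open LeftToRightMinimum lrmin U
    NE : Fin n → Set
    NE k = k ≡ u ⊎ (k ≡ q ⊎ (X e < X k × Y u < Y k))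
    at-u : κ hd ≡ u → NE (κ tee) → ⊥
    at-u hd≡u (inj₁ tee≡u)              = <-irrefl (cong Y (trans tee≡u (sym hd≡u))) tee<hd-Y
    at-u hd≡u (inj₂ (inj₁ tee≡q))       = <⇒≱ two<tee-Y (subst (λ k → Y k ≤ Y (κ two)) (sym tee≡q) (above new<two))
    at-u hd≡u (inj₂ (inj₂ (_ , u<tee))) = <-asym tee<hd-Y (subst (λ k → Y k < Y (κ tee)) (sym hd≡u) u<tee)
    go : NE (κ hd) → ⊥
    go (inj₁ hd≡u)               = at-u hd≡u (northeast _ (right new<tee-pos) (above new<tee))
    go (inj₂ (inj₁ hd≡q))        = <⇒≱ tee<hd-Y (subst (λ k → Y k ≤ Y (κ tee)) (sym hd≡q) (above new<tee))
    -- Now `hd`, and with it every later entry, is right of `e`. All of them are at least as high as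
    -- `q`, hence above `e`, so `e` can play the 1.
    go (inj₂ (inj₂ (e<hd , _))) = replace av e
      (⊥-elim ∘ not-left) (λ lt → <-≤-trans e<hd (hd≤ lt)) (⊥-elim ∘ not-below) above′
      where
      above′ : ∀ {j} → p new < p j → Y e < Y (κ j)
      above′ {j} lt with new-first j
      ... | inj₁ refl = ⊥-elim (<-irrefl refl lt)
      ... | inj₂ (new<j , _) = ≤∧≢⇒<-inj injʸ (≤-trans e≤q (above lt))
            λ e≡κ → <-irrefl (cong X e≡κ) (<-≤-trans e<hd (hd≤ new<j))

  module AboveEast {I : Subset n} (int : Interval X Y I) {i₀ e y : Fin n}
    (i₀∈ : i₀ ∈ I) (lowest : ∀ {j} → j ∈ I → Y i₀ ≤ Y j)
    (no-SW : ∀ {k} → k ∉ I → X k < X i₀ → Y i₀ < Y k)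
    (e∉ : e ∉ I) (i₀<e : X i₀ < X e) (e-above : Y i₀ < Y e)
    (e-first : ∀ {k} → k ∉ I → X i₀ < X k → X e ≤ X k)
    (i₀<y : Y i₀ < Y y)
    (y-lowest : ∀ {k} → k ∉ I → X i₀ < X k → Y i₀ < Y k → Y y ≤ Y k) where
    open Interval int

    right-of : ∀ {r i} → r ∉ I → X i₀ < X r → i ∈ I → X i < X r
    right-of r∉ i₀<r i∈ with beside injˣ convexˣ r∉ i₀∈
    ... | inj₁ r<I = ⊥-elim (<-asym i₀<r (r<I i₀∈))
    ... | inj₂ I<r = I<r i∈

    above-of : ∀ {r i} → r ∉ I → Y i₀ < Y r → i ∈ I → Y i < Y r
    above-of r∉ i₀<r i∈ with beside injʸ convexʸ r∉ i₀∈
    ... | inj₁ r<I = ⊥-elim (<-asym i₀<r (r<I i₀∈))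
    ... | inj₂ I<r = I<r i∈

    east-of : ∀ {r k} → r ∉ I → X i₀ < X r → X r ≤ X k → k ∉ I × X i₀ < X k
    east-of {r} {k} r∉ i₀<r r≤k with k ∈? I
    ... | inj₁ k∈ = ⊥-elim (<⇒≱ (right-of r∉ i₀<r k∈) r≤k)
    ... | inj₂ k∉ = k∉ , <-≤-trans i₀<r r≤k

    module _ {a} (e<a : X e < a) (U : Use p a (suc (Y i₀)) X Y) where
      open Use U

      -- Otherwise `i₀`, which lies to the left and directly below, could play the 1.
      one≢new : one ≢ new
      one≢new refl = replace av i₀ (⊥-elim ∘ not-left)
        (λ lt → <-≤-trans (<-trans i₀<e e<a) (right lt)) (⊥-elim ∘ not-below) above
        where
        not-left : ∀ {j} → ¬ (j F.< new)
        not-left {j} j<new with one-first j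
        ... | inj₁ refl     = F.<-irrefl refl j<new
        ... | inj₂ (lt , _) = F.<-asym lt j<new
        not-below : ∀ {j} → ¬ (p j < p new)
        not-below {j} j<new with one-first j
        ... | inj₁ refl     = <-irrefl refl j<new
        ... | inj₂ (_ , lt) = <-asym lt j<new

      one-before : ∀ {j} → one ≢ j → one F.< j × p one < p j
      one-before {j} one≢j with one-first j
      ... | inj₁ eq = ⊥-elim (one≢j eq)
      ... | inj₂ lt = lt

      -- The two ways a copy can begin: its 1 already lies right of `I`, or its 1 is `i₀` and `hd`
      -- lies right of `I` and above `y`. Either way a point right of `I` occurs before the new
      -- column.
      FromOne FromHd : Set
      FromOne = κ one ∉ I × X i₀ < X (κ one) × X (κ one) < a × Y (κ one) ≤ Y i₀
      FromHd  = κ one ≡ i₀ × hd ≢ new × κ hd ∉ I × X i₀ < X (κ hd) × Y y < Y (κ hd) × X (κ hd) < a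

      -- No height is free between `i₀` and the new point, so the new point plays the 2. By (‡)
      -- `tee` is then northeast of `I`, hence not below `y`, and `hd` is higher still.
      one-in-interval : κ one ≡ i₀ → FromHd
      one-in-interval one≡i₀ = go (two-next new)
        where
        go : one ≡ new ⊎ (two ≡ new ⊎ p two < p new) → FromHd
        go (inj₁ eq)         = ⊥-elim (one≢new eq)
        go (inj₂ (inj₂ two<new)) = ⊥-elim (<⇒≱
          (val one≢new (λ { refl → <-irrefl refl two<new }) one<two)
          (subst (λ k → Y (κ two) ≤ Y k) (sym one≡i₀) (≤-pred (below two<new))))
        go (inj₂ (inj₁ refl)) = one≡i₀ , hd≢two , hd∉ , i₀<hd , y<hd , left hd<two
          where
          tee≢two : tee ≢ two
          tee≢two eq = F.<-irrefl (sym eq) two<tee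
          hd≢two : hd ≢ two
          hd≢two eq = <-asym two<tee-val (subst (λ i → p tee < p i) eq tee<hd)
          hd<two : hd F.< two
          hd<two with hd-next two
          ... | inj₁ eq        = ⊥-elim (one≢two eq)
          ... | inj₂ (inj₁ eq) = ⊥-elim (hd≢two eq)
          ... | inj₂ (inj₂ lt) = lt
          tee-east : κ tee ∉ I × X i₀ < X (κ tee)
          tee-east = east-of e∉ i₀<e (≤-trans (<⇒≤ e<a) (right two<tee))
          i₀<tee : Y i₀ < Y (κ tee)
          i₀<tee = above two<tee-val
          y<hd : Y y < Y (κ hd)
          y<hd = ≤-<-trans (y-lowest (proj₁ tee-east) (proj₂ tee-east) i₀<tee) (val tee≢two hd≢two tee<hd)
          hd∉ : κ hd ∉ I
          hd∉ with κ hd ∈? I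
          ... | inj₂ ∉I = ∉I
          ... | inj₁ ∈I = ⊥-elim (<-asym (val tee≢two hd≢two tee<hd) (above-of (proj₁ tee-east) i₀<tee ∈I))
          i₀<hd : X i₀ < X (κ hd)
          i₀<hd = subst (λ k → X k < X (κ hd)) one≡i₀ (pos one≢new hd≢two one<hd)

      -- The 1 is at most as high as `i₀`. Inside `I` it must therefore be `i₀`; outside it cannot
      -- lie on the left, by `no-SW`.
      front : FromOne ⊎ FromHd
      front with κ one ∈? I
      ... | inj₁ one∈ = inj₂ (one-in-interval (injʸ (≤-antisym (≤-pred (below (proj₂ (one-before one≢new)))) (lowest one∈))))
      ... | inj₂ one∉ with <-cmp (X (κ one)) (X i₀)
      ...   | tri< lt _ _ = ⊥-elim (<⇒≱ (no-SW one∉ lt) (≤-pred (below (proj₂ (one-before one≢new)))))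
      ...   | tri≈ _ eq _ = ⊥-elim (∈∉-≢ I i₀∈ one∉ (sym (injˣ eq)))
      ...   | tri> _ _ gt = inj₁ (one∉ , gt , left (proj₁ (one-before one≢new)) , ≤-pred (below (proj₂ (one-before one≢new))))

      east : ∀ {j} → one ≢ j → j ≢ new → κ j ∉ I × X i₀ < X (κ j)
      east {j} one≢j j≢new with front
      ... | inj₁ (one∉ , i₀<one , _) = east-of one∉ i₀<one (<⇒≤ (pos one≢new j≢new (proj₁ (one-before one≢j))))
      ... | inj₂ (_ , hd≢new , hd∉ , i₀<hd , _) with hd-next j
      ...   | inj₁ eq          = ⊥-elim (one≢j eq)
      ...   | inj₂ (inj₁ refl) = hd∉ , i₀<hd
      ...   | inj₂ (inj₂ lt)   = east-of hd∉ i₀<hd (<⇒≤ (pos hd≢new j≢new lt))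

    -- The only point right of `I` and left of the new column is `e`. It is too high for the 1 of
    -- `FromOne`, and it is `y` itself, so not above `y` as `FromHd` asks.
    after-first-avoids : y ≡ e → ¬ Use p (suc (X e)) (suc (Y i₀)) X Y
    after-first-avoids refl U with front ≤-refl U
    ... | inj₁ (one∉ , i₀<one , one<a , one≤i₀) =
      <⇒≱ e-above (subst (λ k → Y k ≤ Y i₀) (injˣ (≤-antisym (≤-pred one<a) (e-first one∉ i₀<one))) one≤i₀)
    ... | inj₂ (_ , _ , hd∉ , i₀<hd , y<hd , hd<a) =
      <-irrefl (cong Y (injˣ (≤-antisym (e-first hd∉ i₀<hd) (≤-pred hd<a)))) y<hd

    -- If the copy does not use y, then y replaces the new point; otherwise both form an increasing bond.
    before-lowest-avoids : X e < X y → ¬ Use p (X y) (suc (Y i₀)) X Y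
    before-lowest-avoids e<y U with F.any? (λ j → (κ j F.≟ y) ×-dec (new F.<? j))
      where open Use U
    ... | no unused = replace av y left right′ (λ lt → ≤-<-trans (≤-pred (below lt)) i₀<y) above′
      where
      open Use U
      right′ : ∀ {j} → new F.< j → X y < X (κ j)
      right′ {j} lt = ≤∧≢⇒<-inj injˣ (right lt) λ y≡ → unused (j , sym y≡ , lt)
      above′ : ∀ {j} → p new < p j → Y y < Y (κ j)
      above′ {j} lt = ≤∧≢⇒<-inj injʸ (y-lowest (proj₁ κ-east) (proj₂ κ-east) (above lt)) y≢κ
        where
        j≢new : j ≢ new
        j≢new refl = <-irrefl refl lt
        one≢j : one ≢ j
        one≢j refl = <-asym lt (proj₂ (one-before e<y U (one≢new e<y U)))
        κ-east = east e<y U one≢j j≢new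
        y≢κ : y ≢ κ j
        y≢κ y≡κ with F.<-cmp new j
        ... | tri< gt _ _ = unused (j , sym y≡κ , gt)
        ... | tri≈ _ eq _ = j≢new (sym eq)
        ... | tri> _ _ gt = <-irrefl (cong X (sym y≡κ)) (left gt)
    ... | yes (j , κj≡y , new<j) = bond (no-bond new j new<j new<j-val)
      where
      open Use U
      j≢new : j ≢ new
      j≢new refl = F.<-irrefl refl new<j
      new<j-val : p new < p j
      new<j-val with <-cmp (p new) (p j)
      ... | tri< lt _ _ = lt
      ... | tri≈ _ eq _ = ⊥-elim (j≢new (sym (p-injective eq)))
      ... | tri> _ _ gt = ⊥-elim (<⇒≱ i₀<y (subst (λ k → Y k ≤ Y i₀) κj≡y (≤-pred (below gt))))
      -- No entry fits between the new point and `y`: in position because the new point is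
      -- immediately left of `y`, in value because `y` is lowest northeast of `I`.
      bond : ¬ ∃ λ l → (new F.< l × l F.< j) ⊎ (p new < p l × p l < p j)
      bond (l , inj₁ (new<l , l<j)) = <⇒≱ (pos (λ { refl → F.<-irrefl refl new<l }) j≢new l<j)
        (subst (λ k → X k ≤ X (κ l)) (sym κj≡y) (right new<l))
      bond (l , inj₂ (new<l , l<j)) = <⇒≱ (val l≢new j≢new l<j)
        (subst (λ k → Y k ≤ Y (κ l)) (sym κj≡y) (y-lowest (proj₁ κ-east) (proj₂ κ-east) (above new<l)))
        where
        l≢new : l ≢ new
        l≢new refl = <-irrefl refl new<l
        one≢l : one ≢ l
        one≢l refl = <-asym new<l (proj₂ (one-before e<y U (one≢new e<y U)))
        κ-east = east e<y U one≢l l≢new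

-- Counting intervals and cuts

-- The new point of ext a X, ext b Y lies strictly inside the range of I in one coordinate, and is
-- separated from I by a point k ∉ I in the other one.
record Breaks (X Y : Fin n → ℕ) (I : Subset n) (a b : ℕ) : Set where
  field
    {i j k} : Fin n
    i∈  : i ∈ I
    j∈  : j ∈ I
    k∉  : k ∉ I
    separated : ∀ {J} → Interval (ext a X) (ext b Y) J → zero ∉ J → suc i ∈ J → suc j ∈ J → ⊥
    between   : ∀ {J} → Interval (ext a X) (ext b Y) J → zero ∈ J → ∀ {v} → v ∈ I → suc v ∈ J → suc k ∈ J
    meets     : ∀ {J} → Interval (ext a X) (ext b Y) J → zero ∈ J → ∀ {v} → v ∉ I → suc v ∈ J →
                suc i ∈ J ⊎ suc j ∈ J
    sum₁  : ∃ λ l → ¬ SumOrder (ext a X) (ext b Y) zero (suc l)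
    sum₂  : ∃ λ l → ¬ SumOrder (ext a X) (ext b Y) (suc l) zero
    skew₁ : ∃ λ l → ¬ SkewOrder (ext a X) (ext b Y) zero (suc l)
    skew₂ : ∃ λ l → ¬ SkewOrder (ext a X) (ext b Y) (suc l) zero

module _ {Z : Fin n → ℕ} {c : ℕ} where

  convex-separated : ∀ {J i j} → Convex (ext c Z) J → Z i < c → c ≤ Z j →
    zero ∉ J → suc i ∈ J → suc j ∈ J → ⊥
  convex-separated {i = i} {j} conv i<c c≤j 0∉ i∈ j∈ =
    <-asym (old<new {a = c} {Z} {i} i<c) (conv 0∉ j∈ i∈ (new<old {a = c} {Z} {j} c≤j))

  -- The outsider `v` is on one side of all of `I`, so `i` or `j` lies between `v` and the new
  -- point.
  convex-meets : ∀ {I J i j v} → Injective Z → Convex Z I → Convex (ext c Z) J → i ∈ I → j ∈ I →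
    Z i < c → c ≤ Z j → zero ∈ J → v ∉ I → suc v ∈ J → suc i ∈ J ⊎ suc j ∈ J
  convex-meets {I} {J} {i} {j} {v} inj convI convJ i∈ j∈ i<c c≤j 0∈ v∉ v∈J with beside inj convI v∉ i∈
  ... | inj₁ v<I with suc i ∈? J
  ...   | inj₁ i∈J = inj₁ i∈J
  ...   | inj₂ i∉J = ⊥-elim (<-asym (v<I i∈)
            (old<old⁻ {a = c} {Z} {i} {v} (convJ i∉J 0∈ v∈J (old<new {a = c} {Z} {i} i<c))))
  convex-meets {I} {J} {i} {j} {v} inj convI convJ i∈ j∈ i<c c≤j 0∈ v∉ v∈J | inj₂ I<v with suc j ∈? J
  ...   | inj₁ j∈J = inj₂ j∈J
  ...   | inj₂ j∉J = ⊥-elim (<⇒≱ (old<new⁻ {a = c} {Z} {j}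
            (convJ j∉J v∈J 0∈ (old<old {a = c} {Z} {j} {v} (I<v j∈)))) c≤j)

  convex-between-low : ∀ {J k v} → Convex (ext c Z) J → Z k < Z v → c ≤ Z k → zero ∈ J → suc v ∈ J → suc k ∈ J
  convex-between-low {J} {k} {v} conv k<v c≤k 0∈ v∈ with suc k ∈? J
  ... | inj₁ k∈ = k∈
  ... | inj₂ k∉ = ⊥-elim (<⇒≱ (old<new⁻ {a = c} {Z} {k} (conv k∉ v∈ 0∈ (old<old {a = c} {Z} {k} {v} k<v))) c≤k)

  convex-between-high : ∀ {J k v} → Convex (ext c Z) J → Z v < Z k → Z k < c → zero ∈ J → suc v ∈ J → suc k ∈ J
  convex-between-high {J} {k} {v} conv v<k k<c 0∈ v∈ with suc k ∈? J
  ... | inj₁ k∈ = k∈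
  ... | inj₂ k∉ = ⊥-elim (<-asym v<k (old<old⁻ {a = c} {Z} {k} {v} (conv k∉ 0∈ v∈ (old<new {a = c} {Z} {k} k<c))))

  not-new<old : ∀ {i} → Z i < c → ¬ (ext c Z zero < ext c Z (suc i))
  not-new<old {i} i<c lt = <-asym lt (old<new {a = c} {Z} {i} i<c)

  not-old<new : ∀ {i} → c ≤ Z i → ¬ (ext c Z (suc i) < ext c Z zero)
  not-old<new {i} c≤i lt = <-asym lt (new<old {a = c} {Z} {i} c≤i)

module _ {X Y : Fin n → ℕ} (injˣ : Injective X) (injʸ : Injective Y) {I : Subset n} (int : Interval X Y I) {a b : ℕ} where
  open Interval

  -- The column of the new point passes between `i` and `j`, and `k` lies between it and `I` in
  -- height. Having points on both sides also keeps the new point from being a block of a cut by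
  -- itself.
  breaks-vertically : ∀ {i j k} → i ∈ I → j ∈ I → k ∉ I → X i < a → a ≤ X j →
    (∀ {v} → v ∈ I → Y k < Y v) → b ≤ Y k → Breaks X Y I a b
  breaks-vertically {i} {j} {k} i∈ j∈ k∉ i<a a≤j k<I b≤k = record
    { i∈ = i∈ ; j∈ = j∈ ; k∉ = k∉
    ; separated = λ {J} intJ → convex-separated {Z = X} {a} {J} (convexˣ intJ) i<a a≤j
    ; between = λ {J} intJ 0∈ v∈ → convex-between-low {Z = Y} {b} {J} (convexʸ intJ) (k<I v∈) b≤k 0∈
    ; meets = λ {J} intJ 0∈ v∉ v∈ → convex-meets {Z = X} {a} {I} {J} injˣ (convexˣ int) (convexˣ intJ) i∈ j∈ i<a a≤j 0∈ v∉ v∈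
    ; sum₁ = i , λ (lt , _) → not-new<old {Z = X} {a} i<a lt
    ; sum₂ = j , λ (lt , _) → not-old<new {Z = X} {a} a≤j lt
    ; skew₁ = i , λ (lt , _) → not-new<old {Z = X} {a} i<a lt
    ; skew₂ = j , λ (lt , _) → not-old<new {Z = X} {a} a≤j lt
    }

  breaks-horizontally : ∀ {i j k} → i ∈ I → j ∈ I → k ∉ I → Y i < b → b ≤ Y j →
    (∀ {v} → v ∈ I → X v < X k) → X k < a → Breaks X Y I a b
  breaks-horizontally {i} {j} {k} i∈ j∈ k∉ i<b b≤j I<k k<a = record
    { i∈ = i∈ ; j∈ = j∈ ; k∉ = k∉
    ; separated = λ {J} intJ → convex-separated {Z = Y} {b} {J} (convexʸ intJ) i<b b≤j
    ; between = λ {J} intJ 0∈ v∈ → convex-between-high {Z = X} {a} {J} (convexˣ intJ) (I<k v∈) k<a 0∈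
    ; meets = λ {J} intJ 0∈ v∉ v∈ → convex-meets {Z = Y} {b} {I} {J} injʸ (convexʸ int) (convexʸ intJ) i∈ j∈ i<b b≤j 0∈ v∉ v∈
    ; sum₁ = i , λ (_ , lt) → not-new<old {Z = Y} {b} i<b lt
    ; sum₂ = j , λ (_ , lt) → not-old<new {Z = Y} {b} b≤j lt
    ; skew₁ = j , λ (_ , lt) → not-old<new {Z = Y} {b} b≤j lt
    ; skew₂ = i , λ (_ , lt) → not-new<old {Z = Y} {b} i<b lt
    }

NoCut : (Fin n → Fin n → Set) → Set
NoCut R = ∀ S → ¬ Cut R S

-- A cut of the extension can fail to restrict only if the new point alone is one of its blocks;
-- `l₁` and `l₂` exclude this for the first and the second block.
cut-restrict : {R : Fin n → Fin n → Set} {R′ : Fin (suc n) → Fin (suc n) → Set} →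
  (∀ {i j} → R′ (suc i) (suc j) → R i j) →
  (∃ λ l → ¬ R′ zero (suc l)) → (∃ λ l → ¬ R′ (suc l) zero) →
  ∀ {S} → Cut R′ S → Cut R (S ∘ suc)
cut-restrict {R = R} {R′} restrict (l₁ , ¬R₁) (l₂ , ¬R₂) {S} ((i , i∈) , (j , j∉) , before) =
  in-witness i i∈ , out-witness j j∉ , λ i∈ j∉ → restrict (before i∈ j∉)
  where
  in-witness : ∀ i → i ∈ S → ∃ (_∈ (S ∘ suc))
  in-witness (suc i) i∈ = i , i∈
  in-witness zero    0∈ with suc l₁ ∈? S
  ... | inj₁ l∈ = l₁ , l∈
  ... | inj₂ l∉ = ⊥-elim (¬R₁ (before 0∈ l∉))
  out-witness : ∀ j → j ∉ S → ∃ (_∉ (S ∘ suc))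
  out-witness (suc j) j∉ = j , j∉
  out-witness zero    0∉ with suc l₂ ∈? S
  ... | inj₁ l∈ = ⊥-elim (¬R₂ (before l∈ 0∉))
  ... | inj₂ l∉ = l₂ , l∉

module _ {X Y : Fin n → ℕ} {a b : ℕ} where

  sum-restrict : ∀ {i j} → SumOrder (ext a X) (ext b Y) (suc i) (suc j) → SumOrder X Y i j
  sum-restrict {i} {j} (x , y) = old<old⁻ {a = a} {X} {i} {j} x , old<old⁻ {a = b} {Y} {i} {j} y

  skew-restrict : ∀ {i j} → SkewOrder (ext a X) (ext b Y) (suc i) (suc j) → SkewOrder X Y i j
  skew-restrict {i} {j} (x , y) = old<old⁻ {a = a} {X} {i} {j} x , old<old⁻ {a = b} {Y} {j} {i} y

complement : Subset n → Subset n
complement S = not ∘ S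

∈-complement : (S : Subset n) → ∀ {i} → i ∈ complement S → i ∉ S
∈-complement S {i} i∈ with S i
... | false = refl
... | true with () ← i∈

∉-complement : (S : Subset n) → ∀ {i} → i ∉ complement S → i ∈ S
∉-complement S {i} i∉ with S i
... | true = refl
... | false with () ← i∉

complement-∉ : (S : Subset n) → ∀ {i} → i ∈ S → i ∉ complement S
complement-∉ S i∈ rewrite i∈ = refl

complement-∈ : (S : Subset n) → ∀ {i} → i ∉ S → i ∈ complement S
complement-∈ S i∉ rewrite i∉ = refl

infix 4 _⊂_
_⊂_ : Subset n → Subset n → Set
I ⊂ K = (∀ {i} → i ∈ I → i ∈ K) × ∃ λ k → k ∈ K × k ∉ I

module Maximal {X Y : Fin n → ℕ} (injˣ : Injective X) (injʸ : Injective Y)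
  (no-sum : NoCut (SumOrder X Y)) (no-skew : NoCut (SkewOrder X Y))
  {I : Subset n} (int : Interval X Y I) (maximal : ∀ K → Interval X Y K → ¬ (I ⊂ K)) where
  open Interval

  -- If `T` and `I` overlap properly, their union is an interval larger than `I`, unless it is
  -- everything. In that case the complement of `I` lies in `T`, hence on one side of `t` in each
  -- coordinate, and therefore on one side of `I`: a sum or skew cut.
  overlap-⊥ : ∀ {T} → Interval X Y T → ∃ (λ c → c ∈ I × c ∈ T) → ∃ (λ s → s ∈ T × s ∉ I) →
    ∃ (λ t → t ∈ I × t ∉ T) → ⊥
  overlap-⊥ {T} intT (c , c∈I , c∈T) (s , s∈T , s∉I) (t , t∈I , t∉T) with F.any? (λ u → (I u ∨ T u) Bool.≟ false)
  ... | yes out = maximal U union ((λ {i} i∈ → cong (_∨ T i) i∈) , s , s∈U , s∉I)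
    where
    U : Subset n
    U i = I i ∨ T i
    s∈U : s ∈ U
    s∈U rewrite s∈T = Bool.∨-zeroʳ (I s)
    ∉U : ∀ {k} → k ∉ U → k ∉ I × k ∉ T
    ∉U {k} k∉ with I k | T k
    ... | false | false = refl , refl
    ∈U : ∀ {k} → k ∈ U → k ∈ I ⊎ k ∈ T
    ∈U {k} k∈ with I k | T k
    ... | true  | _    = inj₁ refl
    ... | false | true = inj₂ refl
    convex-union : ∀ {Z} → Convex Z I → Convex Z T → Convex Z U
    convex-union {Z} convI convT {k} k∉ i∈ j∈ k<i = from-c (∈U j∈) (to-c (∈U i∈) k<i)
      where
      to-c : ∀ {i} → i ∈ I ⊎ i ∈ T → Z k < Z i → Z k < Z c
      to-c (inj₁ i∈) = convI (proj₁ (∉U k∉)) i∈ c∈I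
      to-c (inj₂ i∈) = convT (proj₂ (∉U k∉)) i∈ c∈T
      from-c : ∀ {j} → j ∈ I ⊎ j ∈ T → Z k < Z c → Z k < Z j
      from-c (inj₁ j∈) = convI (proj₁ (∉U k∉)) c∈I j∈
      from-c (inj₂ j∈) = convT (proj₂ (∉U k∉)) c∈T j∈
    union : Interval X Y U
    union = record
      { two-points = c , s , cong (_∨ T c) c∈I , s∈U , ∈∉-≢ I c∈I s∉I
      ; outside = out
      ; convexˣ = convex-union (convexˣ int) (convexˣ intT)
      ; convexʸ = convex-union (convexʸ int) (convexʸ intT)
      }
  ... | no full = go (side injˣ (convexˣ int) (convexˣ intT)) (side injʸ (convexʸ int) (convexʸ intT))
    where
    rest : ∀ {r} → r ∉ I → r ∈ T
    rest {r} r∉ with r ∈? T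
    ... | inj₁ r∈ = r∈
    ... | inj₂ r∉T = ⊥-elim (full (r , subst₂ (λ u v → u ∨ v ≡ false) (sym r∉) (sym r∉T) refl))
    Before After : (Fin n → ℕ) → Set
    Before Z = ∀ {r i} → r ∉ I → i ∈ I → Z i < Z r
    After  Z = ∀ {r i} → r ∉ I → i ∈ I → Z r < Z i
    side : ∀ {Z} → Injective Z → Convex Z I → Convex Z T → Before Z ⊎ After Z
    side {Z} inj convI convT with beside inj convT t∉T s∈T
    ... | inj₁ t<T = inj₁ λ {r} {i} r∉ i∈ → before r∉ i∈
      where
      before : Before Z
      before r∉ i∈ with beside inj convI r∉ i∈
      ... | inj₁ r<I = ⊥-elim (<-asym (r<I t∈I) (t<T (rest r∉)))
      ... | inj₂ I<r = I<r i∈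
    ... | inj₂ T<t = inj₂ λ {r} {i} r∉ i∈ → convI r∉ t∈I i∈ (T<t (rest r∉))
    I-c : Subset n
    I-c = complement I
    go : Before X ⊎ After X → Before Y ⊎ After Y → ⊥
    go (inj₁ bx) (inj₁ by) = no-sum I ((c , c∈I) , (s , s∉I) , λ i∈ j∉ → bx j∉ i∈ , by j∉ i∈)
    go (inj₁ bx) (inj₂ ay) = no-skew I ((c , c∈I) , (s , s∉I) , λ i∈ j∉ → bx j∉ i∈ , ay j∉ i∈)
    go (inj₂ ax) (inj₁ by) = no-skew I-c ((s , complement-∈ I s∉I) , (c , complement-∉ I c∈I) ,
      λ i∈ j∉ → ax (∈-complement I i∈) (∉-complement I j∉) , by (∈-complement I i∈) (∉-complement I j∉))
    go (inj₂ ax) (inj₂ ay) = no-sum I-c ((s , complement-∈ I s∉I) , (c , complement-∉ I c∈I) ,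
      λ i∈ j∉ → ax (∈-complement I i∈) (∉-complement I j∉) , ay (∈-complement I i∈) (∉-complement I j∉))

  module _ {a b} (br : Breaks X Y I a b) where
    open Breaks br

    Int′ : Subset (suc n) → Set
    Int′ = Interval (ext a X) (ext b Y)

    other : ∀ {J} → Int′ J → zero ∈ J → ∀ {v} → suc v ∈ J → ∃ λ u → suc u ∈ J × v ≢ u
    other intJ 0∈ {v} v∈J with v ∈? I
    ... | inj₁ v∈I = _ , between intJ 0∈ v∈I v∈J , ∈∉-≢ I v∈I k∉
    ... | inj₂ v∉I with meets intJ 0∈ v∉I v∈J
    ...   | inj₁ i∈J = _ , i∈J , ≢-sym (∈∉-≢ I i∈ v∉I)
    ...   | inj₂ j∈J = _ , j∈J , ≢-sym (∈∉-≢ I j∈ v∉I)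

    -- Dropping the new point could cost `J` its second point or its only outsider. The first is
    -- repaired by `other`, the second by `separated`.
    interval-restrict : ∀ J → Int′ J → Interval X Y (J ∘ suc)
    interval-restrict J intJ = record
      { two-points = two-points′ (two-points intJ)
      ; outside = outside′ (outside intJ)
      ; convexˣ = λ {k} {i} {j} k∉ i∈ j∈ lt → old<old⁻ {a = a} {X} {k} {j}
          (convexˣ intJ k∉ i∈ j∈ (old<old {a = a} {X} {k} {i} lt))
      ; convexʸ = λ {k} {i} {j} k∉ i∈ j∈ lt → old<old⁻ {a = b} {Y} {k} {j}
          (convexʸ intJ k∉ i∈ j∈ (old<old {a = b} {Y} {k} {i} lt))
      }
      where
      two-points′ : ∃₂ (λ i j → i ∈ J × j ∈ J × i ≢ j) → ∃₂ λ i j → suc i ∈ J × suc j ∈ J × i ≢ j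
      two-points′ (zero  , zero  , _  , _  , 0≢0) = ⊥-elim (0≢0 refl)
      two-points′ (suc u , suc v , u∈ , v∈ , u≢v) = u , v , u∈ , v∈ , u≢v ∘ cong suc
      two-points′ (zero  , suc v , 0∈ , v∈ , _)   = v , proj₁ (other intJ 0∈ v∈) , v∈ , proj₂ (other intJ 0∈ v∈)
      two-points′ (suc v , zero  , v∈ , 0∈ , _)   = v , proj₁ (other intJ 0∈ v∈) , v∈ , proj₂ (other intJ 0∈ v∈)
      outside′ : ∃ (_∉ J) → ∃ λ u → suc u ∉ J
      outside′ (suc u , u∉) = u , u∉
      outside′ (zero  , 0∉) with suc i ∈? J | suc j ∈? J
      ... | inj₂ i∉ | _       = i , i∉
      ... | inj₁ _  | inj₂ j∉ = j , j∉
      ... | inj₁ i∈ | inj₁ j∈ = ⊥-elim (separated intJ 0∉ i∈ j∈)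

    -- The common restriction would overlap `I` properly: containing the new point forces it to meet
    -- `I` and to leave `I`, while `K` without the new point cannot contain both `i` and `j`.
    no-double : ∀ {J K} → Int′ J → Int′ K → zero ∈ J → zero ∉ K → ¬ (J ∘ suc ≗ K ∘ suc)
    no-double {J} {K} intJ intK 0∈ 0∉ J≗K = overlap-⊥ (interval-restrict J intJ) common extra missing
      where
      v = proj₁ (two-points (interval-restrict J intJ))
      v∈J : suc v ∈ J
      v∈J = proj₁ (proj₂ (proj₂ (two-points (interval-restrict J intJ))))
      common : ∃ λ c → c ∈ I × suc c ∈ J
      common with v ∈? I
      ... | inj₁ v∈I = v , v∈I , v∈J
      ... | inj₂ v∉I with meets intJ 0∈ v∉I v∈J
      ...   | inj₁ i∈J = i , i∈ , i∈J
      ...   | inj₂ j∈J = j , j∈ , j∈J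
      extra : ∃ λ s → suc s ∈ J × s ∉ I
      extra with v ∈? I
      ... | inj₁ v∈I = k , between intJ 0∈ v∈I v∈J , k∉
      ... | inj₂ v∉I = v , v∈J , v∉I
      missing : ∃ λ t → t ∈ I × suc t ∉ J
      missing with suc i ∈? J | suc j ∈? J
      ... | inj₂ i∉J | _        = i , i∈ , i∉J
      ... | inj₁ _   | inj₂ j∉J = j , j∈ , j∉J
      ... | inj₁ i∈J | inj₁ j∈J = ⊥-elim (separated intK 0∉ (trans (sym (J≗K i)) i∈J) (trans (sym (J≗K j)) j∈J))

    -- Restriction injects the new intervals into the old ones and never yields `I`, since `I`
    -- contains `i` and `j` but not `k`. The bound `am I int` counts the old intervals other than
    -- `I`.
    fewer-intervals : ∀ N → AtMost _≗_ (Interval X Y) (suc N) → AtMost _≗_ Int′ N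
    fewer-intervals N am = AtMost-injection (_∘ suc)
      (λ J intJ → interval-restrict J intJ , lost intJ) injective N (am I int)
      where
      lost : ∀ {J} → Int′ J → ¬ (I ≗ J ∘ suc)
      lost {J} intJ I≗J with zero ∈? J
      ... | inj₁ 0∈ = ∈∉-⊥ (between intJ 0∈ i∈ (trans (sym (I≗J i)) i∈)) (trans (sym (I≗J k)) k∉)
      ... | inj₂ 0∉ = separated intJ 0∉ (trans (sym (I≗J i)) i∈) (trans (sym (I≗J j)) j∈)
      injective : ∀ J K → Int′ J → Int′ K → J ∘ suc ≗ K ∘ suc → J ≗ K
      injective J K intJ intK J≗K with zero ∈? J | zero ∈? K
      ... | inj₁ p | inj₁ q = tail-≗ (trans p (sym q)) J≗K
      ... | inj₂ p | inj₂ q = tail-≗ (trans p (sym q)) J≗K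
      ... | inj₁ p | inj₂ q = ⊥-elim (no-double intJ intK p q J≗K)
      ... | inj₂ p | inj₁ q = ⊥-elim (no-double intK intJ q p (sym ∘ J≗K))

-- Choosing a point that breaks a given interval.

module _ {p : Fin m → ℕ} (𝒫 : Pattern p) {X Y : Fin n → ℕ}
  (injˣ : Injective X) (injʸ : Injective Y) (av : Avoids p X Y) where
  open Insertion 𝒫 injˣ injʸ av

  breakable : NoCut (SkewOrder X Y) → ∀ I → Interval X Y I →
    ∃₂ λ a b → ¬ Use p a b X Y × Breaks X Y I a b
  breakable no-skew I int = go
    where
    open Interval int
    x₁ = proj₁ two-points
    x₂ = proj₁ (proj₂ two-points)
    x₁∈ = proj₁ (proj₂ (proj₂ two-points))
    x₂∈ = proj₁ (proj₂ (proj₂ (proj₂ two-points)))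

    another : ∀ u → ∃ λ v → v ∈ I × u ≢ v
    another u with u F.≟ x₁
    ... | no  u≢x₁ = x₁ , x₁∈ , u≢x₁
    ... | yes refl = x₂ , x₂∈ , proj₂ (proj₂ (proj₂ (proj₂ two-points)))

    ∈I? : Decidable (_∈ I)
    ∈I? k = I k Bool.≟ true
    ∉I? : Decidable (_∉ I)
    ∉I? k = I k Bool.≟ false

    bottom = least ∈I? Y (x₁ , x₁∈)
    i₀ = proj₁ bottom
    i₀∈ : i₀ ∈ I
    i₀∈ = proj₁ (proj₂ bottom)
    lowest : ∀ {j} → j ∈ I → Y i₀ ≤ Y j
    lowest = proj₂ (proj₂ bottom) _

    besideˣ : ∀ {k} → k ∉ I → (∀ {j} → j ∈ I → X k < X j) ⊎ (∀ {j} → j ∈ I → X j < X k)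
    besideˣ k∉ = beside injˣ convexˣ k∉ i₀∈
    besideʸ : ∀ {k} → k ∉ I → (∀ {j} → j ∈ I → Y k < Y j) ⊎ (∀ {j} → j ∈ I → Y j < Y k)
    besideʸ k∉ = beside injʸ convexʸ k∉ i₀∈

    Goal : Set
    Goal = ∃₂ λ a b → ¬ Use p a b X Y × Breaks X Y I a b

    left-below : (∃ λ k → k ∉ I × X k < X i₀ × Y k < Y i₀) → Goal
    left-below (s , s∉ , s-left , s-below) = by-order (<-cmp (X x₁) (X x₂))
      where
      west = least {P = λ k → k ∉ I × X k < X i₀} (λ k → ∉I? k ×-dec (X k <? X i₀)) Y (s , s∉ , s-left)
      d = proj₁ west
      d∉ : d ∉ I
      d∉ = proj₁ (proj₁ (proj₂ west))
      d<I : ∀ {j} → j ∈ I → X d < X j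
      d<I j∈ = convexˣ d∉ i₀∈ j∈ (proj₂ (proj₁ (proj₂ west)))
      d-lowest : ∀ {k} → k ∉ I → X k < X i₀ → Y d ≤ Y k
      d-lowest k∉ k<i₀ = proj₂ (proj₂ west) _ (k∉ , k<i₀)
      d-below : ∀ {j} → j ∈ I → Y d < Y j
      d-below j∈ = ≤-<-trans (d-lowest s∉ s-left) (<-≤-trans s-below (lowest j∈))
      insert : ∀ {x y} → x ∈ I → y ∈ I → X x < X y → Goal
      -- The column just left of `y` keeps `x` and `y` on different sides; the height is directly
      -- below `d`.
      insert {x} {y} x∈ y∈ x<y = X y , Y d ,
        below-minimum-avoids (d<I y∈) lrmin ,
        breaks-vertically injˣ injʸ int x∈ y∈ d∉ x<y ≤-refl d-below ≤-refl
        where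
        lrmin : ∀ k → X k < X y → Y d ≤ Y k
        lrmin k k<y with k ∈? I
        ... | inj₁ k∈ = <⇒≤ (d-below k∈)
        ... | inj₂ k∉ with besideˣ k∉
        ...   | inj₁ k<I = d-lowest k∉ (k<I i₀∈)
        ...   | inj₂ I<k = ⊥-elim (<-asym k<y (I<k y∈))
      by-order : _ → Goal
      by-order (tri< lt _ _) = insert x₁∈ x₂∈ lt
      by-order (tri≈ _ eq _) = ⊥-elim (proj₂ (proj₂ (proj₂ (proj₂ two-points))) (injˣ eq))
      by-order (tri> _ _ gt) = insert x₂∈ x₁∈ gt

    module _ (no-SW : ∀ {k} → k ∉ I → X k < X i₀ → Y i₀ < Y k) where

      -- With nothing right of `I`, every outsider is to its left and, by `no-SW`, above it. This is
      -- a skew cut with `I` as second block.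
      right-end : ¬ ∃ (λ k → k ∉ I × X i₀ < X k) → ⊥
      right-end none = no-skew (complement I)
        ((proj₁ outside , complement-∈ I (proj₂ outside)) , (i₀ , complement-∉ I i₀∈) ,
         λ i∈ j∉ → northwest (∈-complement I i∈) (∉-complement I j∉))
        where
        northwest : ∀ {i j} → i ∉ I → j ∈ I → X i < X j × Y j < Y i
        northwest {i} {j} i∉ j∈ with besideˣ i∉
        ... | inj₂ I<i = ⊥-elim (none (i , i∉ , I<i i₀∈))
        ... | inj₁ i<I with besideʸ i∉
        ...   | inj₁ i-below = ⊥-elim (<-asym (i-below i₀∈) (no-SW i∉ (i<I i₀∈)))
        ...   | inj₂ i-above = i<I j∈ , i-above j∈

      module _ {e} (e∉ : e ∉ I) (i₀<e : X i₀ < X e)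
        (e-first : ∀ {k} → k ∉ I → X i₀ < X k → X e ≤ X k) where

        first-below : Y e < Y i₀ → Goal
        -- Just left of the last point `u`, so that any other point of `I` is on the left of the new
        -- column, and just below `q`, which then separates the new point from `I`.
        first-below e-below = X u , Y q ,
          below-east-avoids {u} {q} {e} lrmin northeast (q-highest e∉ e-below) ,
          breaks-vertically injˣ injʸ int (proj₁ (proj₂ (another u))) u∈ q∉
            (≤∧≢⇒<-inj injˣ (u-last (proj₁ (proj₂ (another u)))) (≢-sym (proj₂ (proj₂ (another u)))))
            ≤-refl q-below ≤-refl
          where
          south = greatest {P = λ k → k ∉ I × Y k < Y i₀} (λ k → ∉I? k ×-dec (Y k <? Y i₀)) Y (e , e∉ , e-below)
          q = proj₁ south
          q∉ : q ∉ I
          q∉ = proj₁ (proj₁ (proj₂ south))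
          q-below : ∀ {j} → j ∈ I → Y q < Y j
          q-below j∈ = <-≤-trans (proj₂ (proj₁ (proj₂ south))) (lowest j∈)
          q-highest : ∀ {k} → k ∉ I → Y k < Y i₀ → Y k ≤ Y q
          q-highest k∉ k<i₀ = proj₂ (proj₂ south) _ (k∉ , k<i₀)
          last = greatest ∈I? X (x₁ , x₁∈)
          u = proj₁ last
          u∈ : u ∈ I
          u∈ = proj₁ (proj₂ last)
          u-last : ∀ {j} → j ∈ I → X j ≤ X u
          u-last = proj₂ (proj₂ last) _
          lrmin : ∀ k → X k < X u → Y q ≤ Y k
          lrmin k k<u with k ∈? I
          ... | inj₁ k∈ = <⇒≤ (q-below k∈)
          ... | inj₂ k∉ with besideˣ k∉
          ...   | inj₁ k<I = <⇒≤ (<-trans (q-below i₀∈) (no-SW k∉ (k<I i₀∈)))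
          ...   | inj₂ I<k = ⊥-elim (<-asym k<u (I<k u∈))
          northeast : ∀ k → X u ≤ X k → Y q ≤ Y k → k ≡ u ⊎ (k ≡ q ⊎ (X e < X k × Y u < Y k))
          northeast k u≤k q≤k with k ∈? I
          ... | inj₁ k∈ = inj₁ (injˣ (≤-antisym (u-last k∈) u≤k))
          ... | inj₂ k∉ with besideˣ k∉ | besideʸ k∉
          ...   | inj₁ k<I | _            = ⊥-elim (<⇒≱ (k<I u∈) u≤k)
          ...   | inj₂ I<k | inj₁ k-below = inj₂ (inj₁ (injʸ (≤-antisym (q-highest k∉ (k-below i₀∈)) q≤k)))
          ...   | inj₂ I<k | inj₂ k-above = inj₂ (inj₂ (≤∧≢⇒<-inj injˣ (e-first k∉ (I<k i₀∈)) e≢k , k-above u∈))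
            where
            e≢k : e ≢ k
            e≢k refl = <-asym e-below (k-above i₀∈)

        first-above : Y i₀ < Y e → Goal
        first-above e-above = choose (y F.≟ e)
          where
          ne = least {P = λ k → k ∉ I × X i₀ < X k × Y i₀ < Y k}
            (λ k → ∉I? k ×-dec ((X i₀ <? X k) ×-dec (Y i₀ <? Y k))) Y (e , e∉ , i₀<e , e-above)
          y = proj₁ ne
          y-props = proj₁ (proj₂ ne)
          open AboveEast int {i₀} {e} {y} i₀∈ lowest no-SW e∉ i₀<e e-above e-first
            (proj₂ (proj₂ y-props)) (λ k∉ i₀<k i₀<′k → proj₂ (proj₂ ne) _ (k∉ , i₀<k , i₀<′k))
          -- The height splits `i₀` from the rest of `I`, and `e` separates in position, so any
          -- column right of `e` will do; avoidance alone dictates the choice of `a`.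
          breaks : ∀ {a} → X e < a → Breaks X Y I a (suc (Y i₀))
          breaks = breaks-horizontally injˣ injʸ int i₀∈ (proj₁ (proj₂ (another i₀))) e∉ ≤-refl
            (≤∧≢⇒<-inj injʸ (lowest (proj₁ (proj₂ (another i₀)))) (proj₂ (proj₂ (another i₀))))
            (right-of e∉ i₀<e)
          choose : Dec (y ≡ e) → Goal
          choose (yes y≡e) = _ , _ , after-first-avoids y≡e , breaks ≤-refl
          choose (no  y≢e) = _ , _ , before-lowest-avoids e<y , breaks e<y
            where
            e<y : X e < X y
            e<y = ≤∧≢⇒<-inj injˣ (e-first (proj₁ y-props) (proj₁ (proj₂ y-props))) (≢-sym y≢e)

      first-right : ∃ (λ k → k ∉ I × X i₀ < X k) → Goal
      first-right some with least (λ k → ∉I? k ×-dec (X i₀ <? X k)) X some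
      ... | e , (e∉ , i₀<e) , e-first with <-cmp (Y e) (Y i₀)
      ...   | tri< lt _ _ = first-below e∉ i₀<e (λ k∉ i₀<k → e-first _ (k∉ , i₀<k)) lt
      ...   | tri≈ _ eq _ = ⊥-elim (∈∉-≢ I i₀∈ e∉ (sym (injʸ eq)))
      ...   | tri> _ _ gt = first-above e∉ i₀<e (λ k∉ i₀<k → e-first _ (k∉ , i₀<k)) gt

    go : Goal
    go with F.any? (λ k → ∉I? k ×-dec ((X k <? X i₀) ×-dec (Y k <? Y i₀)))
         | F.any? (λ k → ∉I? k ×-dec (X i₀ <? X k))
    ... | yes sw | _       = left-below sw
    ... | no ¬sw | east? = by-east east?
      where
      no-SW : ∀ {k} → k ∉ I → X k < X i₀ → Y i₀ < Y k
      no-SW {k} k∉ k<i₀ = ≤∧≢⇒<-inj injʸ (≮⇒≥ λ lt → ¬sw (k , k∉ , k<i₀ , lt)) (∈∉-≢ I i₀∈ k∉)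
      by-east : Dec (∃ λ k → k ∉ I × X i₀ < X k) → Goal
      by-east (yes some) = first-right no-SW some
      by-east (no none)  = ⊥-elim (right-end no-SW none)

-- Enlarging to a simple configuration.

record State (p : Fin m → ℕ) (q : Fin l → ℕ) (X Y : Fin n → ℕ) : Set where
  field
    injˣ     : Injective X
    injʸ     : Injective Y
    avoids   : Avoids p X Y
    ψ        : Fin l → Fin n
    contains : Emb q X Y ψ

module _ {p : Fin m → ℕ} {q : Fin l → ℕ} {X Y : Fin n → ℕ} where
  open State

  extend : ∀ {a b} → Fin n → State p q X Y → ¬ Use p a b X Y → State p q (ext a X) (ext b Y)
  extend {a} {b} d st ¬use = record
    { injˣ = ext-injective {a = a} (injˣ st)
    ; injʸ = ext-injective {a = b} (injʸ st)
    ; avoids = ext-avoids d (avoids st) ¬use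
    ; ψ = suc ∘ ψ st
    ; contains = record
      { pos = λ {i} {j} lt → old<old {a = a} {X} {ψ st i} {ψ st j} (Emb.pos (contains st) lt)
      ; val = λ {i} {j} lt → old<old {a = b} {Y} {ψ st i} {ψ st j} (Emb.val (contains st) lt)
      }
    }

module SkewStep {p : Fin m → ℕ} (𝒫 : Pattern p) {X Y : Fin n → ℕ}
  (injˣ : Injective X) (injʸ : Injective Y) (av : Avoids p X Y)
  {S : Subset n} (cut : Cut (SkewOrder X Y) S) where
  open Insertion 𝒫 injˣ injʸ av

  -- The new point goes just left of `c` and just below `t`; these are the only two points northeast
  -- of it.
  nw = greatest (λ k → S k Bool.≟ true) X (proj₁ cut)
  se = greatest (λ k → S k Bool.≟ false) Y (proj₁ (proj₂ cut))
  c = proj₁ nw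
  t = proj₁ se
  c∈ : c ∈ S
  c∈ = proj₁ (proj₂ nw)
  t∉ : t ∉ S
  t∉ = proj₁ (proj₂ se)
  before : ∀ {i j} → i ∈ S → j ∉ S → SkewOrder X Y i j
  before = proj₂ (proj₂ cut)

  use : ¬ Use p (X c) (Y t) X Y
  use = skew-avoids lrmin northeast
    where
    lrmin : ∀ k → X k < X c → Y t ≤ Y k
    lrmin k k<c with k ∈? S
    ... | inj₁ k∈ = <⇒≤ (proj₂ (before k∈ t∉))
    ... | inj₂ k∉ = ⊥-elim (<-asym k<c (proj₁ (before c∈ k∉)))
    northeast : ∀ k → X c ≤ X k → Y t ≤ Y k → k ≡ c ⊎ k ≡ t
    northeast k c≤k t≤k with k ∈? S
    ... | inj₁ k∈ = inj₁ (injˣ (≤-antisym (proj₂ (proj₂ nw) k k∈) c≤k))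
    ... | inj₂ k∉ = inj₂ (injʸ (≤-antisym (proj₂ (proj₂ se) k k∉) t≤k))

  -- With `c` and `t` alone the new point would complete the pattern 132, which is a sum. A third
  -- point lies left of it, if in `S`, or below it, if not, so it is never a first block; `c` on its
  -- right keeps it from being a last block.
  no-sum-cut : (∃ λ d → c ≢ d × t ≢ d) → NoCut (SumOrder X Y) → NoCut (SumOrder (ext (X c) X) (ext (Y t) Y))
  no-sum-cut (d , c≢d , t≢d) no-sum T cutT = no-sum (T ∘ suc) (cut-restrict
    (λ {i} {j} → sum-restrict {X = X} {Y} {X c} {Y t} {i} {j})
    third (c , λ (lt , _) → not-old<new {Z = X} {X c} ≤-refl lt) cutT)
    where
    third : ∃ λ k → ¬ SumOrder (ext (X c) X) (ext (Y t) Y) zero (suc k)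
    third with d ∈? S
    ... | inj₁ d∈ = d , λ (lt , _) → not-new<old {Z = X} {X c} (≤∧≢⇒<-inj injˣ (proj₂ (proj₂ nw) d d∈) (≢-sym c≢d)) lt
    ... | inj₂ d∉ = d , λ (_ , lt) → not-new<old {Z = Y} {Y t} (≤∧≢⇒<-inj injʸ (proj₂ (proj₂ se) d d∉) (≢-sym t≢d)) lt

  Cut′ : Subset (suc n) → Set
  Cut′ = Cut (SkewOrder (ext (X c) X) (ext (Y t) Y))

  t-apart : ∀ {T} → Cut′ T → zero ∈ T → suc t ∈ T
  t-apart {T} (_ , _ , bef) 0∈ with suc t ∈? T
  ... | inj₁ t∈ = t∈
  ... | inj₂ t∉T = ⊥-elim (not-old<new {Z = Y} {Y t} ≤-refl (proj₂ (bef 0∈ t∉T)))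

  c-apart : ∀ {T} → Cut′ T → zero ∉ T → suc c ∉ T
  c-apart {T} (_ , _ , bef) 0∉ with suc c ∈? T
  ... | inj₁ c∈T = ⊥-elim (not-old<new {Z = X} {X c} ≤-refl (proj₁ (bef c∈T 0∉)))
  ... | inj₂ c∉ = c∉

  restrict : ∀ T → Cut′ T → Cut (SkewOrder X Y) (T ∘ suc)
  restrict T = cut-restrict (λ {i} {j} → skew-restrict {X = X} {Y} {X c} {Y t} {i} {j})
    (t , λ (_ , lt) → not-old<new {Z = Y} {Y t} ≤-refl lt)
    (c , λ (lt , _) → not-old<new {Z = X} {X c} ≤-refl lt)

  -- A block containing the new point contains `t` if it is the first and `c` if it is the second.
  -- Hence no new cut restricts to `S`, and two new cuts with equal restriction but different at the
  -- new point would put `t` before `c`.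
  fewer-cuts : ∀ N → AtMost _≗_ (Cut (SkewOrder X Y)) (suc N) → AtMost _≗_ Cut′ N
  fewer-cuts N am = AtMost-injection (_∘ suc) (λ T cutT → restrict T cutT , lost cutT) injective N (am S cut)
    where
    lost : ∀ {T} → Cut′ T → ¬ (S ≗ T ∘ suc)
    lost {T} cutT S≗T with zero ∈? T
    ... | inj₁ 0∈ = ∈∉-⊥ (t-apart cutT 0∈) (trans (sym (S≗T t)) t∉)
    ... | inj₂ 0∉ = ∈∉-⊥ (trans (sym (S≗T c)) c∈) (c-apart cutT 0∉)
    no-double : ∀ {T U} → Cut′ T → Cut′ U → zero ∈ T → zero ∉ U → ¬ (T ∘ suc ≗ U ∘ suc)
    no-double {T} {U} cutT cutU 0∈ 0∉ T≗U = <-asym (proj₁ (before c∈ t∉))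
      (proj₁ (proj₂ (proj₂ (restrict T cutT)) (t-apart cutT 0∈) (trans (T≗U c) (c-apart cutU 0∉))))
    injective : ∀ T U → Cut′ T → Cut′ U → T ∘ suc ≗ U ∘ suc → T ≗ U
    injective T U cutT cutU T≗U with zero ∈? T | zero ∈? U
    ... | inj₁ p | inj₁ q = tail-≗ (trans p (sym q)) T≗U
    ... | inj₂ p | inj₂ q = tail-≗ (trans p (sym q)) T≗U
    ... | inj₁ p | inj₂ q = ⊥-elim (no-double cutT cutU p q T≗U)
    ... | inj₂ p | inj₁ q = ⊥-elim (no-double cutU cutT q p (sym ∘ T≗U))

third-point : (i j : Fin (suc (suc (suc n)))) → ∃ λ d → i ≢ d × j ≢ d
third-point zero          zero          = suc zero , (λ ()) , λ ()
third-point zero          (suc zero)    = suc (suc zero) , (λ ()) , λ ()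
third-point zero          (suc (suc _)) = suc zero , (λ ()) , λ ()
third-point (suc zero)    zero          = suc (suc zero) , (λ ()) , λ ()
third-point (suc (suc _)) zero          = suc zero , (λ ()) , λ ()
third-point (suc _)       (suc _)       = zero , (λ ()) , λ ()

module Simplify {p : Fin m → ℕ} (𝒫 : Pattern p) {q : Fin l → ℕ}
  (no-simple : ∀ {n} {X Y : Fin n → ℕ} → State p q X Y → ¬ (∀ I → ¬ Interval X Y I)) where
  open State

  -- Induction on the bound for intervals: each round breaks a maximal interval, and the restriction
  -- of cuts shows that no sum or skew cut arises.
  break-intervals : ∀ N {n} {X Y : Fin n → ℕ} → State p q X Y →
    NoCut (SumOrder X Y) → NoCut (SkewOrder X Y) → ¬ AtMost _≗_ (Interval X Y) N
  break-intervals zero    st no-sum no-skew am = no-simple st am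
  break-intervals (suc N) {n} {X} {Y} st no-sum no-skew am =
    -- By `no-simple` a contradiction may be derived from an arbitrary interval, so existence of one
    -- is never decided.
    no-simple st λ I int → climb _ I int (proj₂ (subsets-finite _ (Larger I)))
    where
    Larger : Subset n → Subset n → Set
    Larger I K = Interval X Y K × I ⊂ K
    step : ∀ I → Interval X Y I → (∀ K → Interval X Y K → ¬ (I ⊂ K)) → ⊥
    step I int maximal with breakable 𝒫 (injˣ st) (injʸ st) (avoids st) no-skew I int
    ... | a , b , ¬use , br = break-intervals N (extend (proj₁ (Interval.outside int)) st ¬use)
      (λ S cut → no-sum (S ∘ suc) (cut-restrict (λ {i} {j} → sum-restrict {X = X} {Y} {a} {b} {i} {j})
        (Breaks.sum₁ br) (Breaks.sum₂ br) cut))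
      (λ S cut → no-skew (S ∘ suc) (cut-restrict (λ {i} {j} → skew-restrict {X = X} {Y} {a} {b} {i} {j})
        (Breaks.skew₁ br) (Breaks.skew₂ br) cut))
      (Maximal.fewer-intervals (injˣ st) (injʸ st) no-sum no-skew int maximal br N am)
    -- Ascends to a maximal interval: those larger than `K` are larger than `I` and differ from `K`,
    -- so `M` drops. Maximality reaches `step` as the refutation of every larger interval.
    climb : ∀ M I → Interval X Y I → ¬ AtMost _≗_ (Larger I) M
    climb zero    I int larger = step I int λ K intK I⊂K → larger K (intK , I⊂K)
    climb (suc M) I int larger = step I int λ K intK I⊂K → climb M K intK
      (AtMost-⊆ (λ L (intL , K⊂L) → (intL , (λ i∈ → proj₁ K⊂L (proj₁ I⊂K i∈)) ,
          (let k , k∈ , k∉ = proj₂ I⊂K in k , proj₁ K⊂L k∈ , k∉)) ,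
          λ K≗L → let k , k∈ , k∉ = proj₂ K⊂L in ∈∉-⊥ k∈ (trans (sym (K≗L k)) k∉))
        M (larger K (intK , I⊂K)))

  indecomposable-⊥ : ∀ {n} {X Y : Fin n → ℕ} → State p q X Y →
    NoCut (SumOrder X Y) → NoCut (SkewOrder X Y) → ⊥
  indecomposable-⊥ {X = X} {Y} st no-sum no-skew =
    break-intervals _ st no-sum no-skew (proj₂ (subsets-finite _ (Interval X Y)))

  -- The size is at least three so that `third-point` applies. At bound zero, `AtMost` is literally
  -- `NoCut`.
  remove-skew-cuts : ∀ N {n} {X Y : Fin (suc (suc (suc n))) → ℕ} → State p q X Y →
    NoCut (SumOrder X Y) → ¬ AtMost _≗_ (Cut (SkewOrder X Y)) N
  remove-skew-cuts zero    st no-sum am =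
    indecomposable-⊥ st no-sum am
  remove-skew-cuts (suc N) {X = X} {Y} st no-sum am =
    indecomposable-⊥ st no-sum λ S cut → let open SkewStep 𝒫 (injˣ st) (injʸ st) (avoids st) cut in
      remove-skew-cuts N (extend c st use) (no-sum-cut (third-point c t) no-sum) (fewer-cuts N am)

  -- Fewer than two points admit no interval. Otherwise a bottommost and rightmost point is
  -- appended: it can lie in neither block of a sum cut, and it brings the size to at least three.
  impossible : ∀ {n} {X Y : Fin n → ℕ} → ¬ State p q X Y
  impossible {zero} st = no-simple st λ I int → absurd (Interval.outside int)
    where
    absurd : ∀ {I : Subset 0} → ¬ ∃ (_∉ I)
    absurd (() , _)
  impossible {suc zero} st = no-simple st λ I int → absurd (Interval.two-points int)
    where
    absurd : ∀ {I : Subset 1} → ¬ ∃₂ λ i j → i ∈ I × j ∈ I × i ≢ j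
    absurd (zero , zero , _ , _ , 0≢0) = 0≢0 refl
  impossible {suc (suc n)} {X} {Y} st = remove-skew-cuts _ (extend zero st
      (Insertion.append-avoids 𝒫 (injˣ st) (injʸ st) (avoids st) rightmost)) no-sum
      (proj₂ (subsets-finite _ (Cut (SkewOrder (ext a X) (ext 0 Y)))))
    where
    right-end = greatest {P = λ _ → ⊤} (λ _ → yes _) X (zero , _)
    a = suc (X (proj₁ right-end))
    rightmost : ∀ k → X k < a
    rightmost k = s≤s (proj₂ (proj₂ right-end) k _)
    no-sum : NoCut (SumOrder (ext a X) (ext 0 Y))
    no-sum S ((i , i∈) , (j , j∉) , before) = go i i∈ j j∉
      where
      go : ∀ i → i ∈ S → ∀ j → j ∉ S → ⊥
      go zero    i∈ zero    j∉ = ∈∉-⊥ i∈ j∉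
      go zero    i∈ (suc j) j∉ = not-new<old {Z = X} {a} (rightmost j) (proj₁ (before i∈ j∉))
      go (suc i) i∈ j       j∉ with zero ∈? S
      ... | inj₂ 0∉ = not-old<new {Z = Y} {0} {i} z≤n (proj₂ (before i∈ 0∉))
      ... | inj₁ 0∈ with j
      ...   | zero   = ∈∉-⊥ 0∈ j∉
      ...   | suc j′ = not-new<old {Z = X} {a} (rightmost j′) (proj₁ (before 0∈ j∉))

-- Lists and configurations

lookup-AllPairs : {R : A → A → Set} {xs : List A} → AllPairs R xs →
  ∀ {i j} → i F.< j → R (lookup xs i) (lookup xs j)
lookup-AllPairs {xs = x ∷ xs} (px ∷ _)   {zero}  {suc j} _         = All.lookup px (∈-lookup j)
lookup-AllPairs {xs = x ∷ xs} (_ ∷ pxs) {suc i} {suc j} (s≤s i<j) = lookup-AllPairs pxs i<j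

Unique-resp-↭ : {xs ys : List A} → xs ↭ ys → Unique xs → Unique ys
Unique-resp-↭ xs↭ys = ↭ₛ.Unique-resp-↭ (setoid _) (↭⇒↭ₛ xs↭ys)

lookup-injective : {xs : List A} → Unique xs → ∀ {i j} → lookup xs i ≡ lookup xs j → i ≡ j
lookup-injective {xs = xs} uniq {i} {j} eq with F.<-cmp i j
... | tri< lt _ _ = ⊥-elim (lookup-AllPairs uniq {i} {j} lt eq)
... | tri≈ _ e _  = e
... | tri> _ _ gt = ⊥-elim (lookup-AllPairs uniq {j} {i} gt (sym eq))

-- Deleting the head of `xs` from `ys` preserves the inclusion of the tail, in which the head does
-- not recur.
unique-⊆⇒↭ : {xs ys : List A} → Unique xs → (∀ {x} → x ∈ᴸ xs → x ∈ᴸ ys) →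
  length ys ≤ length xs → xs ↭ ys
unique-⊆⇒↭ {xs = []} {[]} _ _ _ = ↭-refl
unique-⊆⇒↭ {xs = x ∷ xs} {ys} (x∉ ∷ uniq) xs⊆ys len with ∈-∃++ (xs⊆ys (here refl))
... | as , bs , refl = ↭-trans (prep x (unique-⊆⇒↭ uniq xs⊆ len′)) (↭-sym (shift x as bs))
  where
  xs⊆ : ∀ {z} → z ∈ᴸ xs → z ∈ᴸ as ++ bs
  xs⊆ z∈ with ∈-++⁻ as (xs⊆ys (there z∈))
  ... | inj₁ z∈as         = ∈-++⁺ˡ z∈as
  ... | inj₂ (here refl)  = ⊥-elim (All.lookup x∉ z∈ refl)
  ... | inj₂ (there z∈bs) = ∈-++⁺ʳ as z∈bs
  len′ : length (as ++ bs) ≤ length xs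
  len′ = ≤-pred (subst (_≤ suc (length xs)) (↭-length (shift x as bs)) len)

⊆-map⁻ : (f : A → B) {zs : List B} {xs : List A} → zs ⊆ map f xs → ∃ λ ys → ys ⊆ xs × zs ≡ map f ys
⊆-map⁻ f {xs = []}     []         = [] , [] , refl
⊆-map⁻ f {xs = x ∷ xs} (_ ∷ʳ sub) with ⊆-map⁻ f sub
... | ys , ys⊆ , eq = ys , x ∷ʳ ys⊆ , eq
⊆-map⁻ f {xs = x ∷ xs} (refl ∷ sub) with ⊆-map⁻ f sub
... | ys , ys⊆ , eq = x ∷ ys , refl ∷ ys⊆ , cong (f x ∷_) eq

All-⊆ : {P : A → Set} {xs ys : List A} → xs ⊆ ys → All P ys → All P xs
All-⊆ xs⊆ys pys = All.tabulate λ x∈ → All.lookup pys (⊆-lookup xs⊆ys x∈)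

AllPairs-⊆ : {R : A → A → Set} {xs ys : List A} → xs ⊆ ys → AllPairs R ys → AllPairs R xs
AllPairs-⊆ []           _          = []
AllPairs-⊆ (_ ∷ʳ sub)   (_ ∷ pys)  = AllPairs-⊆ sub pys
AllPairs-⊆ (refl ∷ sub) (py ∷ pys) = All-⊆ sub py ∷ AllPairs-⊆ sub pys

Increasing : (A → ℕ) → List A → Set
Increasing key = AllPairs λ x y → key x < key y

-- Sorting by the same key turns mere inclusion of elements into a sublist; this is how an embedding
-- becomes a subsequence.
increasing-⊆ : (key : A → ℕ) {xs ys : List A} → Increasing key xs → Increasing key ys →
  (∀ {x} → x ∈ᴸ xs → x ∈ᴸ ys) → xs ⊆ ys
increasing-⊆ key {[]}     {ys}     _          _          _ = minimum ys
increasing-⊆ key {x ∷ xs} {[]}     _          _          sub with () ← sub (here refl)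
increasing-⊆ key {x ∷ xs} {y ∷ ys} (px ∷ pxs) (py ∷ pys) sub with sub (here refl)
... | here refl = refl ∷ increasing-⊆ key pxs pys strengthen
  where
  strengthen : ∀ {z} → z ∈ᴸ xs → z ∈ᴸ ys
  strengthen z∈ with sub (there z∈)
  ... | here refl = ⊥-elim (<-irrefl refl (All.lookup px z∈))
  ... | there z∈′ = z∈′
... | there x∈ = y ∷ʳ increasing-⊆ key (px ∷ pxs) pys strengthen
  where
  strengthen : ∀ {z} → z ∈ᴸ x ∷ xs → z ∈ᴸ ys
  strengthen (here refl) = x∈
  strengthen (there z∈) with sub (there z∈)
  ... | here refl = ⊥-elim (<-asym (All.lookup px z∈) (All.lookup py x∈))
  ... | there z∈′ = z∈′

zip-tabulate : (xs : List ℕ) (g : Fin (length xs) → ℕ) → ∀ {v} → v ∈ᴸ zip xs (tabulate g) →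
  ∃ λ i → v ≡ (lookup xs i , g i)
zip-tabulate (x ∷ xs) g (here refl) = zero , refl
zip-tabulate (x ∷ xs) g (there v∈) with zip-tabulate xs (g ∘ suc) v∈
... | i , eq = suc i , eq

zip-map : (f : A → ℕ) (xs : List ℕ) (ys : List A) (eq : length xs ≡ length ys) → ∀ i →
  (lookup xs i , f (lookup ys (F.cast eq i))) ∈ᴸ zip xs (map f ys)
zip-map f (x ∷ xs) (y ∷ ys) eq zero    = here refl
zip-map f (x ∷ xs) (y ∷ ys) eq (suc i) = there (zip-map f xs ys (suc-injective eq) i)

zip-diagonal : (xs : List ℕ) → ∀ {v} → v ∈ᴸ zip xs xs → proj₁ v ≡ proj₂ v
zip-diagonal (x ∷ xs) (here refl) = refl
zip-diagonal (x ∷ xs) (there v∈)  = zip-diagonal xs v∈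

≼-refl : ∀ α → α ≼ α
≼-refl α = α , ⊆-refl , refl , λ p∈ q∈ →
  mk⇔ (subst₂ _<_ (zip-diagonal α p∈) (zip-diagonal α q∈))
      (subst₂ _<_ (sym (zip-diagonal α p∈)) (sym (zip-diagonal α q∈)))

module _ {X : Fin n → ℕ} (f : Fin n → ℕ) {is : List (Fin n)} (inc : Increasing X is) (α : List ℕ) where

  emb⇒≼ : (∀ k → k ∈ᴸ is) → (∀ {i j} → lookup α i ≡ lookup α j → i ≡ j) →
    ∀ {φ} → Emb (lookup α) X f φ → α ≼ map f is
  emb⇒≼ all inj {φ} emb = map f (tabulate φ) ,
    Sublist.map⁺ f (increasing-⊆ X (AllPairs.tabulate⁺-< (Emb.pos emb)) inc (λ _ → all _)) ,
    trans (sym (length-tabulate φ)) (sym (length-map f (tabulate φ))) , order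
    where
    reflect : ∀ {i j} → f (φ i) < f (φ j) → lookup α i < lookup α j
    reflect {i} {j} lt with <-cmp (lookup α i) (lookup α j)
    ... | tri< α< _ _ = α<
    ... | tri≈ _ eq _ = ⊥-elim (<-irrefl (cong (f ∘ φ) (inj eq)) lt)
    ... | tri> _ _ α> = ⊥-elim (<-asym lt (Emb.val emb α>))
    order : ∀ {v w} → v ∈ᴸ zip α (map f (tabulate φ)) → w ∈ᴸ zip α (map f (tabulate φ)) →
      (proj₁ v < proj₁ w ⇔ proj₂ v < proj₂ w)
    order v∈ w∈ rewrite map-tabulate φ f with zip-tabulate α (f ∘ φ) v∈ | zip-tabulate α (f ∘ φ) w∈
    ... | i , refl | j , refl = mk⇔ (Emb.val emb) reflect

  ≼⇒emb : α ≼ map f is → ∃ λ φ → Emb (lookup α) X f φ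
  ≼⇒emb (_ , s⊆ , len , order) with ⊆-map⁻ f s⊆
  ... | ys , ys⊆ , refl = φ , record
    { pos = λ {i} {j} i<j → lookup-AllPairs (AllPairs-⊆ ys⊆ inc)
        {F.cast eq i} {F.cast eq j} (subst₂ _<_ (sym (F.toℕ-cast eq i)) (sym (F.toℕ-cast eq j)) i<j)
    ; val = λ {i} {j} → Equivalence.to (order (zip-map f α ys eq i) (zip-map f α ys eq j))
    }
    where
    eq : length α ≡ length ys
    eq = trans len (length-map f ys)
    φ : Fin (length α) → Fin n
    φ i = lookup ys (F.cast eq i)

sort-by : {Z : Fin n → ℕ} → Injective Z →
  ∃ λ is → Increasing Z is × (∀ k → k ∈ᴸ is) × Unique is × length is ≡ n
sort-by {n} {Z} inj = sort (allFin n) ,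
  AllPairs.zipWith (λ (i≤j , i≢j) → ≤∧≢⇒<-inj inj i≤j i≢j)
    (Sorted⇒AllPairs totalOrder (sort-↗ (allFin n)) , unique) ,
  (λ k → ∈-resp-↭ (↭-sym (sort-↭ (allFin n))) (∈-allFin k)) , unique ,
  trans (↭-length (sort-↭ (allFin n))) (length-tabulate _)
  where
  open import Relation.Binary.Bundles using (DecTotalOrder)
  order = On.decTotalOrder ≤-decTotalOrder Z
  open DecTotalOrder order using (totalOrder)
  open Sort order using (sort; sort-↭; sort-↗)
  unique : Unique (sort (allFin n))
  unique = Unique-resp-↭ (↭-sym (sort-↭ (allFin n))) (Unique.allFin⁺ n)

-- From configurations to one-line notation.

module Standardize {X Y : Fin n → ℕ} (injˣ : Injective X) (injʸ : Injective Y) where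

  is = proj₁ (sort-by injˣ)
  is-increasing : Increasing X is
  is-increasing = proj₁ (proj₂ (sort-by injˣ))
  is-complete : ∀ k → k ∈ᴸ is
  is-complete = proj₁ (proj₂ (proj₂ (sort-by injˣ)))
  is-unique : Unique is
  is-unique = proj₁ (proj₂ (proj₂ (proj₂ (sort-by injˣ))))
  is-length : length is ≡ n
  is-length = proj₂ (proj₂ (proj₂ (proj₂ (sort-by injˣ))))

  js = proj₁ (sort-by injʸ)
  at : ∀ k → k ∈ᴸ js
  at = proj₁ (proj₂ (proj₂ (sort-by injʸ)))

  -- The position in the list sorted by height, shifted by one because values start at 1.
  rank : Fin n → ℕ
  rank k = suc (toℕ (index (at k)))

  rank-mono : ∀ {i j} → Y i < Y j → rank i < rank j
  rank-mono {i} {j} i<j with F.<-cmp (index (at i)) (index (at j))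
  ... | tri< lt _ _ = s≤s lt
  ... | tri≈ _ eq _ = ⊥-elim (<-irrefl (cong Y
      (trans (lookup-index (at i)) (trans (cong (lookup js) eq) (sym (lookup-index (at j)))))) i<j)
  ... | tri> _ _ gt = ⊥-elim (<-asym i<j (subst₂ (λ u v → Y u < Y v)
      (sym (lookup-index (at j))) (sym (lookup-index (at i)))
      (lookup-AllPairs (proj₁ (proj₂ (sort-by injʸ))) {index (at j)} {index (at i)} gt)))

  rank-reflect : ∀ {i j} → rank i < rank j → Y i < Y j
  rank-reflect {i} {j} lt with <-cmp (Y i) (Y j)
  ... | tri< i<j _ _ = i<j
  ... | tri≈ _ eq _  = ⊥-elim (<-irrefl (cong rank (injʸ eq)) lt)
  ... | tri> _ _ j<i = ⊥-elim (<-asym lt (rank-mono j<i))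

  rank-injective : ∀ {i j} → rank i ≡ rank j → i ≡ j
  rank-injective {i} {j} eq = injʸ (≤-antisym (≮⇒≥ λ lt → <-irrefl (sym eq) (rank-mono lt))
                                              (≮⇒≥ λ lt → <-irrefl eq (rank-mono lt)))

  one-line : List ℕ
  one-line = map rank is

  one-line-length : length one-line ≡ n
  one-line-length = trans (length-map rank is) is-length

  one-line-perm : IsPerm one-line
  one-line-perm rewrite one-line-length = unique-⊆⇒↭ (Unique.map⁺ rank-injective is-unique) in-range
    (≤-reflexive (trans (length-applyUpTo suc n) (sym one-line-length)))
    where
    in-range : ∀ {v} → v ∈ᴸ one-line → v ∈ᴸ applyUpTo suc n
    in-range v∈ with ∈-map⁻ rank v∈
    ... | k , _ , refl = ∈-applyUpTo⁺ suc (subst (toℕ (index (at k)) <_)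
          (proj₂ (proj₂ (proj₂ (proj₂ (sort-by injʸ))))) (F.toℕ<n (index (at k))))

  -- A segment of consecutive values gives an `Interval`: convex in `X` because it is contiguous in
  -- a list sorted by `X`, convex in `Y` because its ranks are consecutive.
  one-line-simple : (∀ I → ¬ Interval X Y I) → IsSimple one-line
  one-line-simple no-interval i k 2≤k k<n (len , c , perm) = no-interval I record
    { two-points = two-points
    ; outside = outside
    ; convexˣ = convexˣ
    ; convexʸ = λ {k} {i} {j} → convexʸ {k} {i} {j}
    }
    where
    open import Data.List.Membership.DecPropositional (F._≟_ {n}) using () renaming (_∈?_ to _∈ᴸ?_)
    open import Relation.Nullary using (does)
    open import Relation.Nullary.Decidable using (dec-true; dec-false)
    seg before after : List (Fin n)
    seg    = take k (drop i is)
    before = take i is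
    after  = drop k (drop i is)
    seg-values : take k (drop i one-line) ≡ map rank seg
    seg-values = trans (cong (take k) (drop-map i is)) (take-map k (drop i is))
    seg-length : length seg ≡ k
    seg-length = trans (sym (length-map rank seg)) (trans (cong length (sym seg-values)) len)
    seg-perm : map rank seg ↭ applyUpTo (c +_) k
    seg-perm = subst (_↭ applyUpTo (c +_) k) seg-values perm
    split : before ++ (seg ++ after) ≡ is
    split = trans (cong (before ++_) (take++drop≡id k (drop i is))) (take++drop≡id i is)
    I : Subset n
    I v = does (v ∈ᴸ? seg)
    ∈I : ∀ {v} → v ∈ I → v ∈ᴸ seg
    ∈I {v} v∈ with v ∈ᴸ? seg
    ... | yes p = p
    ∉I : ∀ {v} → v ∉ I → ¬ v ∈ᴸ seg
    ∉I {v} v∉ with v ∈ᴸ? seg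
    ... | no ¬p = ¬p
    seg-unique : Unique seg
    seg-unique = Unique.take⁺ k (Unique.drop⁺ i is-unique)
    two-points : ∃₂ λ u v → u ∈ I × v ∈ I × u ≢ v
    two-points = at-least-two (subst (2 ≤_) (sym seg-length) 2≤k) seg-unique (λ v∈ → dec-true (_ ∈ᴸ? seg) v∈)
      where
      at-least-two : ∀ {xs : List (Fin n)} → 2 ≤ length xs → Unique xs → (∀ {v} → v ∈ᴸ xs → v ∈ I) →
        ∃₂ λ u v → u ∈ I × v ∈ I × u ≢ v
      at-least-two {u ∷ v ∷ _} _ ((u≢v ∷ _) ∷ _) sub = u , v , sub (here refl) , sub (there (here refl)) , u≢v
      at-least-two {_ ∷ []} (s≤s ())
    outside : ∃ (_∉ I)
    outside with F.any? (λ v → I v Bool.≟ false)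
    ... | yes out = out
    ... | no none = ⊥-elim (<-irrefl (trans (sym seg-length) (trans (sym (↭-length all-seg)) is-length)) k<n′)
      where
      k<n′ : k < n
      k<n′ = subst (k <_) one-line-length k<n
      in-seg : ∀ v → v ∈ᴸ seg
      in-seg v with v ∈? I
      ... | inj₁ v∈ = ∈I v∈
      ... | inj₂ v∉ = ⊥-elim (none (v , v∉))
      all-seg : is ↭ seg
      all-seg = unique-⊆⇒↭ is-unique (λ _ → in-seg _)
        (subst₂ _≤_ (sym seg-length) (sym is-length) (<⇒≤ k<n′))
    ordered : ∀ xs {u v} {ys : List (Fin n)} → Increasing X (xs ++ ys) → u ∈ᴸ xs → v ∈ᴸ ys → X u < X v
    ordered (x ∷ xs) (px ∷ _)  (here refl) v∈ = All.lookup px (∈-++⁺ʳ xs v∈)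
    ordered (x ∷ xs) (_ ∷ pxs) (there u∈)  v∈ = ordered xs pxs u∈ v∈
    convexˣ : Convex X I
    convexˣ {v} {x} {y} v∉ x∈ y∈ v<x with ∈-++⁻ before (subst (v ∈ᴸ_) (sym split) (is-complete v))
    ... | inj₁ v-before = ordered before (subst (Increasing X) (sym split) is-increasing) v-before (∈-++⁺ˡ (∈I y∈))
    ... | inj₂ v∈ with ∈-++⁻ seg v∈
    ...   | inj₁ v-seg   = ⊥-elim (∉I v∉ v-seg)
    ...   | inj₂ v-after = ⊥-elim (<-asym v<x (ordered seg
            (subst (Increasing X) (sym (take++drop≡id k (drop i is))) (AllPairs.drop⁺ i is-increasing)) (∈I x∈) v-after))
    rank∈ : ∀ {v} → v ∈ I → ∃ λ x → x < k × rank v ≡ c + x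
    rank∈ v∈ = ∈-applyUpTo⁻ (c +_) (∈-resp-↭ seg-perm (∈-map⁺ rank (∈I v∈)))
    rank∉ : ∀ {v x} → v ∉ I → x < k → rank v ≢ c + x
    rank∉ {v} v∉ x<k eq with ∈-map⁻ rank (∈-resp-↭ (↭-sym seg-perm)
        (subst (_∈ᴸ applyUpTo (c +_) k) (sym eq) (∈-applyUpTo⁺ (c +_) x<k)))
    ... | u , u∈ , eq′ = ∉I v∉ (subst (_∈ᴸ seg) (sym (rank-injective eq′)) u∈)
    convexʸ : Convex Y I
    convexʸ {v} {x} {y} v∉ x∈ y∈ v<x with rank∈ x∈ | rank∈ y∈
    -- If `v` were not below `y`, its rank would be at least `c` and less than `c + a`, so it would
    -- be one of the ranks of the segment.
    ... | a , a<k , x≡ | b , _ , y≡ = rank-reflect (≰⇒> λ y≤v →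
      let c≤v : c ≤ rank v
          c≤v = ≤-trans (m≤m+n c b) (subst (_≤ rank v) y≡ y≤v)
          v≡ : c + (rank v ∸ c) ≡ rank v
          v≡ = m+[n∸m]≡n c≤v
          v-c<a : rank v ∸ c < a
          v-c<a = +-cancelˡ-< c _ _ (subst₂ _<_ (sym v≡) x≡ (rank-mono v<x))
      in rank∉ v∉ (<-trans v-c<a a<k) (sym v≡))

-- The pattern of 1 ⊕ ρ and the conclusion.

perm-unique : ∀ {α} → IsPerm α → Unique α
perm-unique perm = Unique-resp-↭ (↭-sym perm)
  (Unique.applyUpTo⁺₁ suc _ λ i<j _ eq → <-irrefl (suc-injective eq) i<j)

oneSum-perm : ∀ {ρ} → IsPerm ρ → IsPerm (oneSum ρ)
oneSum-perm {ρ} perm = prep 1 (subst (map suc ρ ↭_)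
  (trans (map-applyUpTo suc suc (length ρ))
    (cong (applyUpTo (λ i → suc (ℕ.suc i))) (sym (length-map suc ρ))))
  (map⁺ suc perm))

lookup-split : ∀ (xs : List A) {v ys} → ∃ λ i → lookup (xs ++ v ∷ ys) i ≡ v ×
  (∀ {y} → y ∈ᴸ ys → ∃ λ j → i F.< j × lookup (xs ++ v ∷ ys) j ≡ y)
lookup-split []       = zero , refl , λ y∈ → suc (index y∈) , s≤s z≤n , sym (lookup-index y∈)
lookup-split (x ∷ xs) with lookup-split xs
... | i , eq , later = suc i , eq , λ y∈ → let j , i<j , eq′ = later y∈ in suc j , s≤s i<j , eq′

split-adjacent : (xs : List A) (i j : Fin (length xs)) → toℕ j ≡ suc (toℕ i) →
  ∃₂ λ ys zs → xs ≡ ys ++ lookup xs i ∷ lookup xs j ∷ zs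
split-adjacent (x ∷ y ∷ xs) zero    (suc zero) _  = [] , xs , refl
split-adjacent (x ∷ xs)     (suc i) (suc j)    eq with split-adjacent xs i j (suc-injective eq)
... | ys , zs , eq′ = x ∷ ys , zs , cong (x ∷_) eq′

module _ (a b : ℕ) (rest : List ℕ) (perm : IsPerm (a ∷ b ∷ rest))
  (no-bond : NoIncreasingBond (oneSum (a ∷ b ∷ rest)))
  (dagger : Ddagger (oneSum (a ∷ b ∷ rest)) (suc a)) where

  private
    ρ π : List ℕ
    ρ = a ∷ b ∷ rest
    π = oneSum ρ
    π-perm : IsPerm π
    π-perm = oneSum-perm perm
    p : Fin (length π) → ℕ
    p = lookup π
    p-injective : ∀ {i j} → p i ≡ p j → i ≡ j
    p-injective = lookup-injective (perm-unique π-perm)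

    entry-two : ∃ λ i → p i ≡ 2 × ∃ λ j → i F.< j × p j < suc a
    entry-two =
      let xs , ys , π≡ , y , y∈ , y<a = dagger
          i , eq , later = lookup-split xs
          j , i<j , eq′ = later y∈
      in subst (λ α → ∃ λ i → lookup α i ≡ 2 × ∃ λ j → i F.< j × lookup α j < suc a) (sym π≡)
           (i , eq , j , i<j , subst (_< suc a) (sym eq′) y<a)

    two≤ : ∀ j → 2 ≤ p (suc j)
    two≤ j with ∈-map⁻ suc (∈-lookup {xs = map suc ρ} j)
    ... | r , r∈ , eq with ∈-applyUpTo⁻ suc (∈-resp-↭ perm r∈)
    ...   | s , _ , refl = subst (2 ≤_) (sym eq) (s≤s (s≤s z≤n))

    -- If the positions are not adjacent, the one after `i` is between; if the values are not,
    -- `suc (p i)` occurs in `π` and is between. If both are adjacent, the pair is an increasing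
    -- bond.
    adjacent-gap : ∀ i j → i F.< j → p i < p j → ∃ λ k → (i F.< k × k F.< j) ⊎ (p i < p k × p k < p j)
    adjacent-gap i j i<j pi<pj with toℕ j Data.Nat.≟ suc (toℕ i) | p j Data.Nat.≟ suc (p i)
    ... | no not-next | _ = F.fromℕ< i⁺<m , inj₁
          (subst (toℕ i <_) (sym (F.toℕ-fromℕ< i⁺<m)) ≤-refl , subst (_< toℕ j) (sym (F.toℕ-fromℕ< i⁺<m)) i⁺<j)
      where
      i⁺<j : suc (toℕ i) < toℕ j
      i⁺<j = ≤∧≢⇒< i<j (≢-sym not-next)
      i⁺<m : suc (toℕ i) < length π
      i⁺<m = <-trans i⁺<j (F.toℕ<n j)
    ... | yes next | yes bond with split-adjacent π i j next
    ...   | ys , zs , eq = ⊥-elim (no-bond ys (p i) zs (subst (λ v → π ≡ ys ++ p i ∷ v ∷ zs) bond eq))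
    adjacent-gap i j i<j pi<pj | yes _ | no not-bond = index v∈ , inj₂
      (subst (p i <_) (lookup-index v∈) ≤-refl , subst (_< p j) (lookup-index v∈) pi⁺<pj)
      where
      pi⁺<pj : suc (p i) < p j
      pi⁺<pj = ≤∧≢⇒< pi<pj (≢-sym not-bond)
      bounded : p i < length π
      bounded with ∈-applyUpTo⁻ suc (∈-resp-↭ π-perm (∈-lookup {xs = π} j))
      ... | s , s<m , eq = <-trans (≤-pred (subst (suc (p i) <_) eq pi⁺<pj)) s<m
      v∈ : suc (p i) ∈ᴸ π
      v∈ = ∈-resp-↭ (↭-sym π-perm) (∈-applyUpTo⁺ suc bounded)

  oneSum-pattern : Pattern p
  oneSum-pattern = record
    { one = zero ; two = two ; hd = suc zero ; tee = tee
    ; p-injective = p-injective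
    ; one-first = λ { zero → inj₁ refl ; (suc j) → inj₂ (s≤s z≤n , two≤ j) }
    ; two-next = λ { zero → inj₁ refl ; (suc j) → inj₂ (two-or-more j) }
    ; hd-next = λ { zero → inj₁ refl ; (suc zero) → inj₂ (inj₁ refl) ; (suc (suc j)) → inj₂ (inj₂ (s≤s (s≤s z≤n))) }
    ; one<two = subst (1 <_) (sym two≡) ≤-refl
    ; one<hd = s≤s z≤n
    ; two<tee = proj₁ (proj₂ (proj₂ (proj₂ entry-two)))
    ; tee<hd = proj₂ (proj₂ (proj₂ (proj₂ entry-two)))
    ; no-bond = adjacent-gap
    }
    where
    two = proj₁ entry-two
    two≡ : p two ≡ 2
    two≡ = proj₁ (proj₂ entry-two)
    tee = proj₁ (proj₂ (proj₂ entry-two))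
    two-or-more : ∀ j → two ≡ suc j ⊎ p two < p (suc j)
    two-or-more j with two F.≟ suc j
    ... | yes eq = inj₁ eq
    ... | no ≢j = inj₂ (≤∧≢⇒< (subst (_≤ p (suc j)) (sym two≡) (two≤ j)) (≢j ∘ p-injective))

list-state : ∀ {π σ} → IsPerm π → IsPerm σ → ¬ (π ≼ σ) → State (lookup π) (lookup σ) toℕ (lookup σ)
list-state {π} {σ} π-perm σ-perm av = record
  { injˣ = F.toℕ-injective
  ; injʸ = lookup-injective (perm-unique σ-perm)
  ; avoids = λ φ emb → av (subst (π ≼_) (trans (map-tabulate (λ i → i) (lookup σ)) (tabulate-lookup σ))
      (emb⇒≼ {X = toℕ} (lookup σ) (AllPairs.tabulate⁺-< λ i<j → i<j) π ∈-allFin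
        (lookup-injective (perm-unique π-perm)) emb))
  ; ψ = λ i → i
  ; contains = record { pos = λ i<j → i<j ; val = λ i<j → i<j }
  }

theorem3p4 : (a b : ℕ) (rest : List ℕ) →
    IsPerm (a ∷ b ∷ rest) → b < a →
    NoIncreasingBond (oneSum (a ∷ b ∷ rest)) →
    Ddagger (oneSum (a ∷ b ∷ rest)) (suc a) →
    ¬ Deflatable (Av (oneSum (a ∷ b ∷ rest)))
theorem3p4 a b rest perm _ no-bond dagger (D , ((_ , D-closed) , _ , σ , (σ-perm , σ-avoids) , σ∉D) , C⊆) =
  Simplify.impossible (oneSum-pattern a b rest perm no-bond dagger) in-simple
    (list-state (oneSum-perm perm) σ-perm σ-avoids)
  where
  π = oneSum (a ∷ b ∷ rest)
  in-simple : ∀ {n} {X Y : Fin n → ℕ} → State (lookup π) (lookup σ) X Y → ¬ (∀ I → ¬ Interval X Y I)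
  in-simple {X = X} st no-interval = σ∉D (D-closed τ σ τ∈D σ-perm σ≼τ)
    where
    open State st
    open Standardize injˣ injʸ
    τ = one-line
    τ-avoids : ¬ (π ≼ τ)
    τ-avoids π≼τ with ≼⇒emb {X = X} rank is-increasing π π≼τ
    ... | φ , emb = avoids φ record { pos = Emb.pos emb ; val = λ lt → rank-reflect (Emb.val emb lt) }
    τ∈D : D τ
    -- The simple `τ` contains itself, so lying in the substitution closure puts it in `D`; closure
    -- of `D` downwards then forces `σ` into `D`.
    τ∈D = proj₂ (C⊆ τ (one-line-perm , τ-avoids)) τ (one-line-simple no-interval) one-line-perm (≼-refl τ)
    σ≼τ : σ ≼ τ
    σ≼τ = emb⇒≼ {X = X} rank is-increasing σ is-complete (lookup-injective (perm-unique σ-perm))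
      record { pos = Emb.pos contains ; val = λ lt → rank-mono (Emb.val contains lt) }
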